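{- The following schemes are provable in $\mathrm{PAI}$: (a) (Apartness) for every $n\in\omega$ and every $\mathcal{L}_{\mathrm{A}}$-formula $\varphi(x_1,\dots,x_n,y)$: $$\forall i\in I\ \forall j\in I\,\big[i<j\to\forall x_1,\dots,x_n<i\,\big(\exists y\,\varphi(\bar x,y)\to\exists y<j\,\varphi(\bar x,y)\big)\big];$$ (b) (Diagonal indiscernibility) for all $n,r\in\omega$ with $r\geq1$ and every $\mathcal{L}_{\mathrm{A}}$-formula $\varphi$ with $n+1+r$ free variables: $$\forall i\in I\ \forall\bar j\in[I]^r\ \forall\bar k\in[I]^r\ \big[(i<j_1)\wedge(i<k_1)\big]\to\big[\forall x_1,\dots,x_n<i\,\big(\varphi(\bar x,i,j_1,\dots,j_r)\leftrightarrow\varphi(\bar x,i,k_1,\dots,k_r)\big)\big].$$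
   Context: $\mathcal{L}_{\mathrm{A}}=\{+,\cdot,\mathrm{S},<,0\}$. $\mathrm{PAI}$ is the theory in $\mathcal{L}_{\mathrm{A}}\cup\{I\}$ ($I$ unary, written $x\in I$) with axioms: (1) $\mathrm{PA}$ together with induction for all formulae of $\mathcal{L}_{\mathrm{A}}\cup\{I\}$; (2) "$I$ is unbounded"; (3) for each $\mathcal{L}_{\mathrm{A}}$-formula $\varphi(v_1,\dots,v_n)$: for all $x_1<\dots<x_n$ in $I$ and $y_1<\dots<y_n$ in $I$, $\varphi(\bar x)\leftrightarrow\varphi(\bar y)$. $\forall\bar j\in[I]^r$ quantifies over increasing $r$-tuples $j_1<\dots<j_r$ of elements of $I$. -}

module Defs where

open import Data.Nat using (ℕ; zero; suc; _+_; _∸_; _<ᵇ_; _≡ᵇ_; _<_; _≤_)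
open import Data.Bool using (if_then_else_)
open import Data.Unit using (⊤)
open import Data.Product using (_×_)

data Lang : Set where
  LA  : Lang
  LAI : Lang

infixl 7 _⊗_
infixl 6 _⊕_

data Tm : Set where
  var  : ℕ → Tm
  `0   : Tm
  S    : Tm → Tm
  _⊕_  : Tm → Tm → Tm
  _⊗_  : Tm → Tm → Tm

infix  5 _≐_ _<'_
infixr 3 _⇒_

data Fm : Lang → Set where
  _≐_  : ∀ {L} → Tm → Tm → Fm L
  _<'_ : ∀ {L} → Tm → Tm → Fm L
  ⊥'   : ∀ {L} → Fm L
  _⇒_  : ∀ {L} → Fm L → Fm L → Fm L
  ∀'   : ∀ {L} → Fm L → Fm L
  _∈I  : Tm → Fm LAI

emb : ∀ {L} → Fm L → Fm LAI
emb (s ≐ t)  = s ≐ t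
emb (s <' t) = s <' t
emb ⊥'       = ⊥'
emb (φ ⇒ ψ)  = emb φ ⇒ emb ψ
emb (∀' φ)   = ∀' (emb φ)
emb (t ∈I)   = t ∈I

infixr 4 _∧'_
infix  2 _⇔_

¬' : ∀ {L} → Fm L → Fm L
¬' φ = φ ⇒ ⊥'

_∧'_ : ∀ {L} → Fm L → Fm L → Fm L
φ ∧' ψ = ¬' (φ ⇒ ¬' ψ)

∃' : ∀ {L} → Fm L → Fm L
∃' φ = ¬' (∀' (¬' φ))

_⇔_ : ∀ {L} → Fm L → Fm L → Fm L
φ ⇔ ψ = (φ ⇒ ψ) ∧' (ψ ⇒ φ)

renT : (ℕ → ℕ) → Tm → Tm
renT ρ (var k) = var (ρ k)
renT ρ `0      = `0
renT ρ (S t)   = S (renT ρ t)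
renT ρ (s ⊕ t) = renT ρ s ⊕ renT ρ t
renT ρ (s ⊗ t) = renT ρ s ⊗ renT ρ t

liftS : (ℕ → Tm) → ℕ → Tm
liftS σ zero    = var zero
liftS σ (suc k) = renT suc (σ k)

subT : (ℕ → Tm) → Tm → Tm
subT σ (var k) = σ k
subT σ `0      = `0
subT σ (S t)   = S (subT σ t)
subT σ (s ⊕ t) = subT σ s ⊕ subT σ t
subT σ (s ⊗ t) = subT σ s ⊗ subT σ t

subF : ∀ {L} → (ℕ → Tm) → Fm L → Fm L
subF σ (s ≐ t)  = subT σ s ≐ subT σ t
subF σ (s <' t) = subT σ s <' subT σ t
subF σ ⊥'       = ⊥'
subF σ (φ ⇒ ψ)  = subF σ φ ⇒ subF σ ψ
subF σ (∀' φ)   = ∀' (subF (liftS σ) φ)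
subF σ (t ∈I)   = subT σ t ∈I

_∷σ_ : Tm → (ℕ → Tm) → ℕ → Tm
(t ∷σ σ) zero    = t
(t ∷σ σ) (suc k) = σ k

inst : ∀ {L} → Fm L → Tm → Fm L
inst φ t = subF (t ∷σ var) φ

shift : ∀ {L} → Fm L → Fm L
shift = subF (λ k → var (suc k))

TmBelow : ℕ → Tm → Set
TmBelow m (var k) = k < m
TmBelow m `0      = ⊤
TmBelow m (S t)   = TmBelow m t
TmBelow m (s ⊕ t) = TmBelow m s × TmBelow m t
TmBelow m (s ⊗ t) = TmBelow m s × TmBelow m t

FreeBelow : ∀ {L} → ℕ → Fm L → Set
FreeBelow m (s ≐ t)  = TmBelow m s × TmBelow m t
FreeBelow m (s <' t) = TmBelow m s × TmBelow m t
FreeBelow m ⊥'       = ⊤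
FreeBelow m (φ ⇒ ψ)  = FreeBelow m φ × FreeBelow m ψ
FreeBelow m (∀' φ)   = FreeBelow (suc m) φ
FreeBelow m (t ∈I)   = TmBelow m t

Sentence : ∀ {L} → Fm L → Set
Sentence = FreeBelow zero

closeN : ∀ {L} → ℕ → Fm L → Fm L
closeN zero    φ = φ
closeN (suc m) φ = closeN m (∀' φ)

Theory : Set₁
Theory = Fm LAI → Set

infix 1 _⊢_

data _⊢_ (T : Theory) : Fm LAI → Set where
  ax    : ∀ {φ} → T φ → T ⊢ φ
  ax-K  : ∀ {φ ψ} → T ⊢ φ ⇒ ψ ⇒ φ
  ax-S  : ∀ {φ ψ χ} → T ⊢ (φ ⇒ ψ ⇒ χ) ⇒ (φ ⇒ ψ) ⇒ φ ⇒ χ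
  ax-DN : ∀ {φ} → T ⊢ ¬' (¬' φ) ⇒ φ
  ax-∀E : ∀ {φ} t → T ⊢ ∀' φ ⇒ inst φ t
  ax-∀D : ∀ {φ ψ} → T ⊢ ∀' (φ ⇒ ψ) ⇒ ∀' φ ⇒ ∀' ψ
  ax-∀V : ∀ {φ} → T ⊢ φ ⇒ ∀' (shift φ)
  ax-=R : ∀ t → T ⊢ t ≐ t
  ax-=S : ∀ {φ} s t → T ⊢ s ≐ t ⇒ inst φ s ⇒ inst φ t
  mp    : ∀ {φ ψ} → T ⊢ φ ⇒ ψ → T ⊢ φ → T ⊢ ψ
  gen   : ∀ {φ} → T ⊢ φ → T ⊢ ∀' φ

incRest : ℕ → Fm LAI → Fm LAI
incRest zero    ψ = ψ
incRest (suc m) ψ = ∀' (var 0 ∈I ⇒ var 1 <' var 0 ⇒ incRest m ψ)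

incBlock : ℕ → Fm LAI → Fm LAI
incBlock zero    ψ = ψ
incBlock (suc m) ψ = ∀' (var 0 ∈I ⇒ incRest m ψ)

-- ∀ x₁ < i … ∀ xₙ < i  ψ,  where i currently has de Bruijn index b
belowBlock : ℕ → ℕ → Fm LAI → Fm LAI
belowBlock b zero    ψ = ψ
belowBlock b (suc m) ψ = ∀' (var 0 <' var (suc b) ⇒ belowBlock (suc b) m ψ)

-- φ(x̄) ↔ φ(ȳ) for increasing x̄, ȳ ∈ [I]^n.  Convention: φ has free
-- variables among v₁,…,vₙ with vₖ the de Bruijn index n ∸ k.
indiscAxiom : ℕ → Fm LA → Fm LAI
indiscAxiom n φ =
  incBlock n (incBlock n (subF (λ m → var (n + m)) (emb φ) ⇔ emb φ))

indAxiom : ℕ → Fm LAI → Fm LAI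
indAxiom m φ =
  closeN m ((inst φ `0 ∧' ∀' (φ ⇒ subF (S (var 0) ∷σ (λ k → var (suc k))) φ))
            ⇒ ∀' φ)

data PAI : Theory where
  pa1 : PAI (∀' (¬' (S (var 0) ≐ `0)))
  pa2 : PAI (∀' (∀' (S (var 1) ≐ S (var 0) ⇒ var 1 ≐ var 0)))
  pa3 : PAI (∀' (var 0 ⊕ `0 ≐ var 0))
  pa4 : PAI (∀' (∀' (var 1 ⊕ S (var 0) ≐ S (var 1 ⊕ var 0))))
  pa5 : PAI (∀' (var 0 ⊗ `0 ≐ `0))
  pa6 : PAI (∀' (∀' (var 1 ⊗ S (var 0) ≐ var 1 ⊗ var 0 ⊕ var 1)))
  pa7 : PAI (∀' (∀' (var 1 <' var 0 ⇔ ∃' (var 2 ⊕ S (var 0) ≐ var 1))))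
  ind : ∀ m (φ : Fm LAI) → FreeBelow (suc m) φ → PAI (indAxiom m φ)
  unb : PAI (∀' (∃' (var 0 ∈I ∧' var 1 <' var 0)))
  indisc : ∀ n (φ : Fm LA) → FreeBelow n φ → PAI (indiscAxiom n φ)

-- (a) Apartness.  φ(x₁,…,xₙ,y): y has index 0, xₖ has index n + 1 ∸ k.
-- ∀i∈I ∀j∈I [i<j → ∀x̄<i (∃y φ → ∃y<j φ)]
Apartness : ℕ → Fm LA → Fm LAI
Apartness n φ =
  ∀' (var 0 ∈I ⇒ ∀' (var 0 ∈I ⇒ var 1 <' var 0 ⇒
    belowBlock 1 n
      (∃' (emb φ) ⇒ ∃' (var 0 <' var (suc n) ∧' emb φ))))

-- (b) Diagonal indiscernibility.  φ(x₁,…,xₙ,i,j₁,…,jᵣ): jₜ has index r ∸ t,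
-- i has index r, xₖ has index r + 1 + (n ∸ k).
-- In the body (context i, j₁..jᵣ, k₁..kᵣ, x₁..xₙ) the variables are
-- xₖ ↦ n ∸ k, kₜ ↦ n + (r ∸ t), jₜ ↦ n + r + (r ∸ t), i ↦ n + 2r.
diagSub : ℕ → ℕ → ℕ → ℕ → Tm
diagSub n r off m =
  if m <ᵇ r then var (off + m)
  else if m ≡ᵇ r then var (n + (r + r))
  else var (m ∸ suc r)

Diagonal : ℕ → ℕ → Fm LA → Fm LAI
Diagonal n r φ =
  ∀' (var 0 ∈I ⇒
    incBlock r (incBlock r
      ((var (r + r) <' var (r + r ∸ 1) ∧' var (r + r) <' var (r ∸ 1)) ⇒
        belowBlock (r + r) n
          (subF (diagSub n r (n + r)) (emb φ)
            ⇔ subF (diagSub n r n) (emb φ)))))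

{-# OPTIONS --safe #-}

-- Both schemes are verified in an arbitrary classical model of PAI and then transferred by a constructive
-- completeness theorem.  In a model:
-- (a) By collection there is u bounding the least witnesses for all x̄ < i; some j' ∈ I exceeds u, so j' has
-- the required property of j, and indiscernibility of the pairs (i , j') and (i , j) transfers it to j.
-- (b) By induction on n.  For fixed i, induction on x shows that there is j ∈ I such that all increasing blocks
-- J < L in I above j satisfy the same φ(x', x̄, i, ·) for all x' < x and x̄ < i: if some J < L disagree at x,
-- then x is definable from i, J, L as the first disagreement, so for blocks beyond L the induction hypothesis,
-- applied to a formula with 3r parameters from I, gives agreement at x.  At x = i indiscernibility removes
-- the bound j, and two arbitrary blocks are compared with a third one above both.
module Submission where

open import Defs
open import Data.Bool using (true; false; T)
open import Data.Empty using (⊥-elim)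
open import Data.List using (List; []; _∷_; _++_; map)
open import Data.List.Relation.Unary.All as All using (All; []; _∷_)
open import Data.List.Relation.Unary.All.Properties using (++⁺)
open import Data.Nat using (ℕ; zero; suc; _+_; _∸_; _≤_; _<_; _<ᵇ_; _≡ᵇ_; _⊔_; z≤n; s≤s; _≟_)
open import Data.Nat.Properties
open import Data.Product using (∃; _×_; _,_; proj₁; proj₂)
open import Data.Sum using (_⊎_; inj₁; inj₂)
open import Data.Unit using (⊤; tt)
open import Function using (_∘_; id)
open import Relation.Binary.PropositionalEquality
open import Relation.Nullary using (yes; no)

-- Syntax and the calculus

TmBelow-mono : ∀ {m n} t → m ≤ n → TmBelow m t → TmBelow n t
TmBelow-mono (var k) m≤n k<m       = ≤-trans k<m m≤n
TmBelow-mono `0      m≤n _         = tt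
TmBelow-mono (S t)   m≤n b         = TmBelow-mono t m≤n b
TmBelow-mono (s ⊕ t) m≤n (b , c)   = TmBelow-mono s m≤n b , TmBelow-mono t m≤n c
TmBelow-mono (s ⊗ t) m≤n (b , c)   = TmBelow-mono s m≤n b , TmBelow-mono t m≤n c

FreeBelow-mono : ∀ {L m n} (φ : Fm L) → m ≤ n → FreeBelow m φ → FreeBelow n φ
FreeBelow-mono (s ≐ t)  m≤n (b , c) = TmBelow-mono s m≤n b , TmBelow-mono t m≤n c
FreeBelow-mono (s <' t) m≤n (b , c) = TmBelow-mono s m≤n b , TmBelow-mono t m≤n c
FreeBelow-mono ⊥'       m≤n _       = tt
FreeBelow-mono (φ ⇒ ψ)  m≤n (b , c) = FreeBelow-mono φ m≤n b , FreeBelow-mono ψ m≤n c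
FreeBelow-mono (∀' φ)   m≤n b       = FreeBelow-mono φ (s≤s m≤n) b
FreeBelow-mono (t ∈I)   m≤n b       = TmBelow-mono t m≤n b

boundT : Tm → ℕ
boundT (var k) = suc k
boundT `0      = 0
boundT (S t)   = boundT t
boundT (s ⊕ t) = boundT s ⊔ boundT t
boundT (s ⊗ t) = boundT s ⊔ boundT t

-- An upper bound rather than the least one: it is not lowered under a quantifier, which spares a
-- predecessor.
bound : ∀ {L} → Fm L → ℕ
bound (s ≐ t)  = boundT s ⊔ boundT t
bound (s <' t) = boundT s ⊔ boundT t
bound ⊥'       = 0
bound (φ ⇒ ψ)  = bound φ ⊔ bound ψ
bound (∀' φ)   = bound φ
bound (t ∈I)   = boundT t

boundT-below : ∀ t → TmBelow (boundT t) t
boundT-below (var k) = ≤-refl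
boundT-below `0      = tt
boundT-below (S t)   = boundT-below t
boundT-below (s ⊕ t) = TmBelow-mono s (m≤m⊔n _ _) (boundT-below s) , TmBelow-mono t (m≤n⊔m (boundT s) _) (boundT-below t)
boundT-below (s ⊗ t) = TmBelow-mono s (m≤m⊔n _ _) (boundT-below s) , TmBelow-mono t (m≤n⊔m (boundT s) _) (boundT-below t)

bound-below : ∀ {L} (φ : Fm L) → FreeBelow (bound φ) φ
bound-below (s ≐ t)  = TmBelow-mono s (m≤m⊔n _ _) (boundT-below s) , TmBelow-mono t (m≤n⊔m (boundT s) _) (boundT-below t)
bound-below (s <' t) = TmBelow-mono s (m≤m⊔n _ _) (boundT-below s) , TmBelow-mono t (m≤n⊔m (boundT s) _) (boundT-below t)
bound-below ⊥'       = tt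
bound-below (φ ⇒ ψ)  = FreeBelow-mono φ (m≤m⊔n _ _) (bound-below φ) , FreeBelow-mono ψ (m≤n⊔m (bound φ) _) (bound-below ψ)
bound-below (∀' φ)   = FreeBelow-mono φ (n≤1+n _) (bound-below φ)
bound-below (t ∈I)   = boundT-below t

subT-local : ∀ {m σ τ} t → TmBelow m t → (∀ k → k < m → σ k ≡ τ k) → subT σ t ≡ subT τ t
subT-local (var k) b       e = e k b
subT-local `0      b       e = refl
subT-local (S t)   b       e = cong S (subT-local t b e)
subT-local (s ⊕ t) (b , c) e = cong₂ _⊕_ (subT-local s b e) (subT-local t c e)
subT-local (s ⊗ t) (b , c) e = cong₂ _⊗_ (subT-local s b e) (subT-local t c e)

-- Substitutions are functions and no extensionality is assumed, so they are compared pointwise on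
-- the variables that can occur. For `m` equal to 0 this makes sentences immune to substitution.
subF-local : ∀ {L m σ τ} (φ : Fm L) → FreeBelow m φ → (∀ k → k < m → σ k ≡ τ k) → subF σ φ ≡ subF τ φ
subF-local (s ≐ t)  (b , c) e = cong₂ _≐_ (subT-local s b e) (subT-local t c e)
subF-local (s <' t) (b , c) e = cong₂ _<'_ (subT-local s b e) (subT-local t c e)
subF-local ⊥'       b       e = refl
subF-local (φ ⇒ ψ)  (b , c) e = cong₂ _⇒_ (subF-local φ b e) (subF-local ψ c e)
subF-local (∀' φ)   b       e = cong ∀' (subF-local φ b λ
  { zero _ → refl ; (suc k) (s≤s k<m) → cong (renT suc) (e k k<m) })
subF-local (t ∈I)   b       e = cong _∈I (subT-local t b e)

subF-cong : ∀ {L σ τ} (φ : Fm L) → σ ≗ τ → subF σ φ ≡ subF τ φ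
subF-cong φ e = subF-local φ (bound-below φ) λ k _ → e k

subT-renT : ∀ {σ ρ} t → subT σ (renT ρ t) ≡ subT (σ ∘ ρ) t
subT-renT (var k) = refl
subT-renT `0      = refl
subT-renT (S t)   = cong S (subT-renT t)
subT-renT (s ⊕ t) = cong₂ _⊕_ (subT-renT s) (subT-renT t)
subT-renT (s ⊗ t) = cong₂ _⊗_ (subT-renT s) (subT-renT t)

renT-subT : ∀ {ρ σ} t → renT ρ (subT σ t) ≡ subT (renT ρ ∘ σ) t
renT-subT (var k) = refl
renT-subT `0      = refl
renT-subT (S t)   = cong S (renT-subT t)
renT-subT (s ⊕ t) = cong₂ _⊕_ (renT-subT s) (renT-subT t)
renT-subT (s ⊗ t) = cong₂ _⊗_ (renT-subT s) (renT-subT t)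

subT-subT : ∀ {σ τ} t → subT σ (subT τ t) ≡ subT (subT σ ∘ τ) t
subT-subT (var k) = refl
subT-subT `0      = refl
subT-subT (S t)   = cong S (subT-subT t)
subT-subT (s ⊕ t) = cong₂ _⊕_ (subT-subT s) (subT-subT t)
subT-subT (s ⊗ t) = cong₂ _⊗_ (subT-subT s) (subT-subT t)

subT-var : ∀ t → subT var t ≡ t
subT-var (var k) = refl
subT-var `0      = refl
subT-var (S t)   = cong S (subT-var t)
subT-var (s ⊕ t) = cong₂ _⊕_ (subT-var s) (subT-var t)
subT-var (s ⊗ t) = cong₂ _⊗_ (subT-var s) (subT-var t)

liftS-liftS : ∀ {σ τ} → subT (liftS σ) ∘ liftS τ ≗ liftS (subT σ ∘ τ)
liftS-liftS zero = refl
liftS-liftS {τ = τ} (suc k) = trans (subT-renT (τ k)) (sym (renT-subT (τ k)))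

subF-subF : ∀ {L σ τ} (φ : Fm L) → subF σ (subF τ φ) ≡ subF (subT σ ∘ τ) φ
subF-subF (s ≐ t)  = cong₂ _≐_ (subT-subT s) (subT-subT t)
subF-subF (s <' t) = cong₂ _<'_ (subT-subT s) (subT-subT t)
subF-subF ⊥'       = refl
subF-subF (φ ⇒ ψ)  = cong₂ _⇒_ (subF-subF φ) (subF-subF ψ)
subF-subF (∀' φ)   = cong ∀' (trans (subF-subF φ) (subF-cong φ liftS-liftS))
subF-subF (t ∈I)   = cong _∈I (subT-subT t)

liftS-var : liftS var ≗ var
liftS-var zero    = refl
liftS-var (suc k) = refl

subF-var : ∀ {L} (φ : Fm L) → subF var φ ≡ φ
subF-var (s ≐ t)  = cong₂ _≐_ (subT-var s) (subT-var t)
subF-var (s <' t) = cong₂ _<'_ (subT-var s) (subT-var t)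
subF-var ⊥'       = refl
subF-var (φ ⇒ ψ)  = cong₂ _⇒_ (subF-var φ) (subF-var ψ)
subF-var (∀' φ)   = cong ∀' (trans (subF-cong φ liftS-var) (subF-var φ))
subF-var (t ∈I)   = cong _∈I (subT-var t)

inst-liftS : ∀ {L σ t} (φ : Fm L) → inst (subF (liftS σ) φ) t ≡ subF (t ∷σ σ) φ
inst-liftS {σ = σ} φ = trans (subF-subF φ) (subF-cong φ λ
  { zero → refl ; (suc k) → trans (subT-renT (σ k)) (subT-var (σ k)) })

closeN-closed : ∀ {L} m (φ : Fm L) → FreeBelow m φ → Sentence (closeN m φ)
closeN-closed zero    φ b = b
closeN-closed (suc m) φ b = closeN-closed m (∀' φ) b

-- Derived rules: substitution, deduction from hypotheses, fresh variables

module _ {T : Theory} where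

  ⊢-cast : ∀ {φ ψ} → φ ≡ ψ → T ⊢ φ → T ⊢ ψ
  ⊢-cast refl d = d

  gens : ∀ m {φ} → T ⊢ φ → T ⊢ closeN m φ
  gens zero    d = d
  gens (suc m) d = gens m (gen d)

  -- The quantifiers are instantiated from the outermost inwards: the tail of `σ` is used first and
  -- `σ 0`, for variable 0, last.
  closeN-elim : ∀ m {φ} σ → T ⊢ subF (λ k → σ (m + k)) (closeN m φ) → T ⊢ subF σ φ
  closeN-elim zero        σ d = d
  closeN-elim (suc m) {φ} σ d =
    ⊢-cast (trans (inst-liftS φ) (subF-cong φ λ { zero → refl ; (suc k) → refl }))
      (mp (ax-∀E (σ 0)) (closeN-elim m {∀' φ} (σ ∘ suc) d))

  -- The calculus has no substitution rule: generalise to a sentence, which substitution leaves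
  -- alone, then instantiate its quantifiers by `σ`.
  ⊢-subF : ∀ {φ} σ → T ⊢ φ → T ⊢ subF σ φ
  ⊢-subF {φ} σ d = closeN-elim m σ
    (⊢-cast (trans (sym (subF-var _)) (subF-local (closeN m φ) (closeN-closed m φ (bound-below φ)) λ _ ()))
      (gens m d))
    where m = bound φ

  ⊢-I : ∀ {φ} → T ⊢ φ ⇒ φ
  ⊢-I {φ} = mp (mp ax-S ax-K) (ax-K {ψ = φ})

  -- Pushing the head of the context onto the conclusion makes the deduction theorem definitional.
  infixr 2 _⇛_
  _⇛_ : List (Fm LAI) → Fm LAI → Fm LAI
  []      ⇛ φ = φ
  (ψ ∷ Γ) ⇛ φ = Γ ⇛ (ψ ⇒ φ)

  ⇛-pure : ∀ Γ {φ} → T ⊢ φ → T ⊢ Γ ⇛ φ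
  ⇛-pure []      d = d
  ⇛-pure (ψ ∷ Γ) d = ⇛-pure Γ (mp ax-K d)

  ⇛-mp : ∀ Γ {φ ψ} → T ⊢ Γ ⇛ (φ ⇒ ψ) → T ⊢ Γ ⇛ φ → T ⊢ Γ ⇛ ψ
  ⇛-mp []      d e = mp d e
  ⇛-mp (χ ∷ Γ) d e = ⇛-mp Γ (⇛-mp Γ (⇛-pure Γ ax-S) d) e

  ⇛-++ʳ : ∀ Γ {Δ φ} → T ⊢ Γ ⇛ φ → T ⊢ (Γ ++ Δ) ⇛ φ
  ⇛-++ʳ []      {Δ} d = ⇛-pure Δ d
  ⇛-++ʳ (ψ ∷ Γ)     d = ⇛-++ʳ Γ d

  ⇛-++ˡ : ∀ Δ {Γ φ} → T ⊢ Γ ⇛ φ → T ⊢ (Δ ++ Γ) ⇛ φ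
  ⇛-++ˡ []      d = d
  ⇛-++ˡ (ψ ∷ Δ) {Γ} d = ⇛-mp (Δ ++ Γ) (⇛-pure (Δ ++ Γ) ax-K) (⇛-++ˡ Δ d)

  -- Freshness is expressed by shifting `Γ`; `ax-∀D` and `ax-∀V` carry the quantifier past one
  -- hypothesis at a time.
  ⇛-gen : ∀ Γ {φ} → T ⊢ map shift Γ ⇛ φ → T ⊢ Γ ⇛ ∀' φ
  ⇛-gen []      d = gen d
  ⇛-gen (ψ ∷ Γ) d =
    ⇛-mp Γ (⇛-mp Γ (⇛-pure Γ ax-S) (⇛-mp Γ (⇛-pure Γ ax-K) (⇛-mp Γ (⇛-pure Γ ax-∀D) (⇛-gen Γ d))))
           (⇛-pure Γ ax-∀V)

  subF-⇛ : ∀ {k σ} Γ φ → All (FreeBelow k) Γ → (∀ a → a < k → σ a ≡ var (suc a)) →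
           subF σ (Γ ⇛ φ) ≡ (map shift Γ ⇛ subF σ φ)
  subF-⇛ []      φ []      e = refl
  subF-⇛ (ψ ∷ Γ) φ (b ∷ bs) e =
    trans (subF-⇛ Γ (ψ ⇒ φ) bs e) (cong (λ θ → map shift Γ ⇛ (θ ⇒ _)) (subF-local ψ b e))

  -- Renaming `k` to 0 and moving every other variable up by one turns the instance at the fresh
  -- variable into the premise of `⇛-gen`.
  ⇛-fresh : ∀ {k φ} Γ → All (FreeBelow k) Γ → FreeBelow k φ → T ⊢ Γ ⇛ inst φ (var k) → T ⊢ Γ ⇛ ∀' φ
  ⇛-fresh {k} {φ} Γ bs b d = ⇛-gen Γ (⊢-cast eq (⊢-subF σ d))
    where
    σ : ℕ → Tm
    σ a with a ≟ k
    ... | yes _ = var 0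
    ... | no  _ = var (suc a)
    σ-< : ∀ a → a < k → σ a ≡ var (suc a)
    σ-< a a<k with a ≟ k
    ... | yes refl = ⊥-elim (<-irrefl refl a<k)
    ... | no _     = refl
    σ-k : σ k ≡ var 0
    σ-k with k ≟ k
    ... | yes _ = refl
    ... | no k≢k = ⊥-elim (k≢k refl)
    eq : subF σ (Γ ⇛ inst φ (var k)) ≡ (map shift Γ ⇛ φ)
    eq = trans (subF-⇛ Γ _ bs σ-<) (cong (map shift Γ ⇛_)
      (trans (subF-subF φ) (trans (subF-local φ b λ
        { zero _ → σ-k ; (suc a) a<k → σ-< a (<-trans (n<1+n a) a<k) }) (subF-var φ))))

  infix 1 _⊩_
  -- `P` may be undecidable; only the finite list of hypotheses actually used is recorded.
  _⊩_ : (Fm LAI → Set) → Fm LAI → Set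
  P ⊩ φ = ∃ λ Γ → All P Γ × (T ⊢ Γ ⇛ φ)

  module _ {P : Fm LAI → Set} where
    ⊩-pure : ∀ {φ} → T ⊢ φ → P ⊩ φ
    ⊩-pure d = [] , [] , d

    ⊩-hyp : ∀ {φ} → P φ → P ⊩ φ
    ⊩-hyp {φ} p = φ ∷ [] , p ∷ [] , ⊢-I

    ⊩-mp : ∀ {φ ψ} → P ⊩ φ ⇒ ψ → P ⊩ φ → P ⊩ ψ
    ⊩-mp (Γ , ps , d) (Δ , qs , e) = Γ ++ Δ , ++⁺ ps qs , ⇛-mp (Γ ++ Δ) (⇛-++ʳ Γ d) (⇛-++ˡ Γ e)

    ⊩-S : ∀ {θ φ ψ} → P ⊩ θ ⇒ φ ⇒ ψ → P ⊩ θ ⇒ φ → P ⊩ θ ⇒ ψ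
    ⊩-S d e = ⊩-mp (⊩-mp (⊩-pure ax-S) d) e

    ⊩-K : ∀ {θ φ} → P ⊩ φ → P ⊩ θ ⇒ φ
    ⊩-K d = ⊩-mp (⊩-pure ax-K) d

    ⊩-DN : ∀ {φ} → P ⊩ ¬' (¬' φ) → P ⊩ φ
    ⊩-DN = ⊩-mp (⊩-pure ax-DN)

    ⊩-efq : ∀ {φ} → P ⊩ ⊥' → P ⊩ φ
    ⊩-efq d = ⊩-DN (⊩-K d)

  ⊢-efq : ∀ {φ} → T ⊢ ⊥' ⇒ φ
  ⊢-efq = mp (mp ax-S (mp ax-K ax-DN)) ax-K

  module _ {P : Fm LAI → Set} where
    ⊩-¬⇒ˡ : ∀ {φ ψ} → P ⊩ ¬' (φ ⇒ ψ) → P ⊩ φ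
    ⊩-¬⇒ˡ d = ⊩-DN (⊩-S (⊩-K d) (⊩-S (⊩-K (⊩-pure (mp ax-S (mp ax-K ⊢-efq)))) (⊩-pure ⊢-I)))

    ⊩-¬⇒ʳ : ∀ {φ ψ} → P ⊩ ¬' (φ ⇒ ψ) → P ⊩ ¬' ψ
    ⊩-¬⇒ʳ d = ⊩-S (⊩-K d) (⊩-pure ax-K)

    -- Every use of `θ` carries evidence for `E`, so a scan of the finite list either finds only
    -- members of `P` or produces that evidence. Whether `E` holds is never decided.
    ⊩-split : ∀ {θ φ} {E : Set} → (λ ψ → P ψ ⊎ (ψ ≡ θ × E)) ⊩ φ → (P ⊩ φ) ⊎ (E × (P ⊩ θ ⇒ φ))
    ⊩-split ([] , [] , d) = inj₁ (⊩-pure d)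
    ⊩-split (ψ ∷ Γ , p ∷ ps , d) with ⊩-split (Γ , ps , d) | p
    ... | inj₁ d'       | inj₁ q          = inj₁ (⊩-mp d' (⊩-hyp q))
    ... | inj₁ d'       | inj₂ (refl , e) = inj₂ (e , d')
    ... | inj₂ (e , d') | inj₁ q          = inj₂ (e , ⊩-S d' (⊩-K (⊩-hyp q)))
    ... | inj₂ (e , d') | inj₂ (refl , _) = inj₂ (e , ⊩-S d' (⊩-pure ⊢-I))

  ⊩-mono : ∀ {P Q : Fm LAI → Set} {φ} → (∀ {ψ} → P ψ → Q ψ) → P ⊩ φ → Q ⊩ φ
  ⊩-mono f (Γ , ps , d) = Γ , All.map f ps , d

-- An enumeration of all formulas

step : ℕ × ℕ → ℕ × ℕ
step (zero  , b) = suc b , zero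
step (suc a , b) = a , suc b

unpair : ℕ → ℕ × ℕ
unpair zero    = 0 , 0
unpair (suc n) = step (unpair n)

-- The walk `step` runs down each antidiagonal from (s , 0) to (0 , s) and continues at (s + 1 , 0);
-- the recursion follows it backwards.
unpair-onto : ∀ s a b → a + b ≡ s → ∃ λ n → unpair n ≡ (a , b)
unpair-onto s a (suc b) e with unpair-onto s (suc a) b (trans (sym (+-suc a b)) e)
... | n , eq = suc n , cong step eq
unpair-onto s       zero    zero e = 0 , refl
unpair-onto (suc s) (suc a) zero e with unpair-onto s 0 a (suc-injective (trans (cong suc (sym (+-identityʳ a))) e))
... | n , eq = suc n , cong step eq

pair : ℕ → ℕ → ℕ
pair a b = proj₁ (unpair-onto (a + b) a b refl)

unpair-pair : ∀ a b → unpair (pair a b) ≡ (a , b)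
unpair-pair a b = proj₂ (unpair-onto (a + b) a b refl)

-- The first argument is fuel bounding the nesting depth, which makes the recursion structural;
-- `enum` reads it off its index. Numbers that code nothing get a default value.
decodeT : ℕ → ℕ → Tm
decodeT′ : ℕ → ℕ × ℕ → Tm
decodeT zero    c = `0
decodeT (suc f) c = decodeT′ f (unpair c)
decodeT′ f (0 , c) = var c
decodeT′ f (1 , c) = S (decodeT f c)
decodeT′ f (2 , c) = decodeT f (proj₁ (unpair c)) ⊕ decodeT f (proj₂ (unpair c))
decodeT′ f (3 , c) = decodeT f (proj₁ (unpair c)) ⊗ decodeT f (proj₂ (unpair c))
decodeT′ f (_ , c) = `0

codeT : Tm → ℕ
codeT (var k) = pair 0 k
codeT `0      = pair 4 0
codeT (S t)   = pair 1 (codeT t)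
codeT (s ⊕ t) = pair 2 (pair (codeT s) (codeT t))
codeT (s ⊗ t) = pair 3 (pair (codeT s) (codeT t))

depthT : Tm → ℕ
depthT (var k) = 1
depthT `0      = 1
depthT (S t)   = suc (depthT t)
depthT (s ⊕ t) = suc (depthT s ⊔ depthT t)
depthT (s ⊗ t) = suc (depthT s ⊔ depthT t)

decodeT-codeT : ∀ f t → depthT t ≤ f → decodeT f (codeT t) ≡ t
decodeT-codeT (suc f) (var k) _ rewrite unpair-pair 0 k = refl
decodeT-codeT (suc f) `0      _ rewrite unpair-pair 4 0 = refl
decodeT-codeT (suc f) (S t)   (s≤s l) rewrite unpair-pair 1 (codeT t) = cong S (decodeT-codeT f t l)
decodeT-codeT (suc f) (s ⊕ t) (s≤s l)
  rewrite unpair-pair 2 (pair (codeT s) (codeT t)) | unpair-pair (codeT s) (codeT t) =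
  cong₂ _⊕_ (decodeT-codeT f s (m⊔n≤o⇒m≤o _ _ l)) (decodeT-codeT f t (m⊔n≤o⇒n≤o (depthT s) _ l))
decodeT-codeT (suc f) (s ⊗ t) (s≤s l)
  rewrite unpair-pair 3 (pair (codeT s) (codeT t)) | unpair-pair (codeT s) (codeT t) =
  cong₂ _⊗_ (decodeT-codeT f s (m⊔n≤o⇒m≤o _ _ l)) (decodeT-codeT f t (m⊔n≤o⇒n≤o (depthT s) _ l))

decode : ℕ → ℕ → Fm LAI
decode′ : ℕ → ℕ × ℕ → Fm LAI
decode zero    c = ⊥'
decode (suc f) c = decode′ f (unpair c)
decode′ f (0 , c) = decodeT f (proj₁ (unpair c)) ≐ decodeT f (proj₂ (unpair c))
decode′ f (1 , c) = decodeT f (proj₁ (unpair c)) <' decodeT f (proj₂ (unpair c))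
decode′ f (2 , c) = decode f (proj₁ (unpair c)) ⇒ decode f (proj₂ (unpair c))
decode′ f (3 , c) = ∀' (decode f c)
decode′ f (4 , c) = decodeT f c ∈I
decode′ f (_ , c) = ⊥'

code : Fm LAI → ℕ
code (s ≐ t)  = pair 0 (pair (codeT s) (codeT t))
code (s <' t) = pair 1 (pair (codeT s) (codeT t))
code ⊥'       = pair 5 0
code (φ ⇒ ψ)  = pair 2 (pair (code φ) (code ψ))
code (∀' φ)   = pair 3 (code φ)
code (t ∈I)   = pair 4 (codeT t)

depth : Fm LAI → ℕ
depth (s ≐ t)  = suc (depthT s ⊔ depthT t)
depth (s <' t) = suc (depthT s ⊔ depthT t)
depth ⊥'       = 1
depth (φ ⇒ ψ)  = suc (depth φ ⊔ depth ψ)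
depth (∀' φ)   = suc (depth φ)
depth (t ∈I)   = suc (depthT t)

decode-code : ∀ f φ → depth φ ≤ f → decode f (code φ) ≡ φ
decode-code (suc f) (s ≐ t) (s≤s l)
  rewrite unpair-pair 0 (pair (codeT s) (codeT t)) | unpair-pair (codeT s) (codeT t) =
  cong₂ _≐_ (decodeT-codeT f s (m⊔n≤o⇒m≤o _ _ l)) (decodeT-codeT f t (m⊔n≤o⇒n≤o (depthT s) _ l))
decode-code (suc f) (s <' t) (s≤s l)
  rewrite unpair-pair 1 (pair (codeT s) (codeT t)) | unpair-pair (codeT s) (codeT t) =
  cong₂ _<'_ (decodeT-codeT f s (m⊔n≤o⇒m≤o _ _ l)) (decodeT-codeT f t (m⊔n≤o⇒n≤o (depthT s) _ l))
decode-code (suc f) ⊥' _ rewrite unpair-pair 5 0 = refl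
decode-code (suc f) (φ ⇒ ψ) (s≤s l)
  rewrite unpair-pair 2 (pair (code φ) (code ψ)) | unpair-pair (code φ) (code ψ) =
  cong₂ _⇒_ (decode-code f φ (m⊔n≤o⇒m≤o _ _ l)) (decode-code f ψ (m⊔n≤o⇒n≤o (depth φ) _ l))
decode-code (suc f) (∀' φ) (s≤s l) rewrite unpair-pair 3 (code φ) = cong ∀' (decode-code f φ l)
decode-code (suc f) (t ∈I) (s≤s l) rewrite unpair-pair 4 (codeT t) = cong _∈I (decodeT-codeT f t l)

abstract
  enum : ℕ → Fm LAI
  enum n = decode (proj₁ (unpair n)) (proj₂ (unpair n))

  enum-onto : ∀ φ → ∃ λ n → enum n ≡ φ
  enum-onto φ = pair (depth φ) (code φ) , eq
    where
    eq : enum (pair (depth φ) (code φ)) ≡ φ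
    eq rewrite unpair-pair (depth φ) (code φ) = decode-code (depth φ) φ ≤-refl

-- Structures and completeness

infixr 5 _◂_
_◂_ : {A : Set} → A → (ℕ → A) → ℕ → A
(a ◂ ρ) zero    = a
(a ◂ ρ) (suc k) = ρ k

Iff : Set → Set → Set
Iff A B = (A → B) × (B → A)

-- The interpretation Bot of falsum is an arbitrary set, so classical reasoning is available for every
-- formula as soon as the atoms are stable for the negation A → Bot.
record Structure : Set₁ where
  field
    D           : Set
    zer         : D
    suc'        : D → D
    plus times  : D → D → D
    Eq Lt       : D → D → Set
    In          : D → Set
    Bot         : Set

module Semantics (M : Structure) where
  open Structure M public

  Neg : Set → Set
  Neg A = A → Bot

  Env : Set
  Env = ℕ → D

  ⟦_⟧ₜ : Tm → Env → D
  ⟦ var k ⟧ₜ ρ = ρ k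
  ⟦ `0 ⟧ₜ    ρ = zer
  ⟦ S t ⟧ₜ   ρ = suc' (⟦ t ⟧ₜ ρ)
  ⟦ s ⊕ t ⟧ₜ ρ = plus (⟦ s ⟧ₜ ρ) (⟦ t ⟧ₜ ρ)
  ⟦ s ⊗ t ⟧ₜ ρ = times (⟦ s ⟧ₜ ρ) (⟦ t ⟧ₜ ρ)

  ⟦_⟧ : ∀ {L} → Fm L → Env → Set
  ⟦ s ≐ t ⟧  ρ = Eq (⟦ s ⟧ₜ ρ) (⟦ t ⟧ₜ ρ)
  ⟦ s <' t ⟧ ρ = Lt (⟦ s ⟧ₜ ρ) (⟦ t ⟧ₜ ρ)
  ⟦ ⊥' ⟧     ρ = Bot
  ⟦ φ ⇒ ψ ⟧  ρ = ⟦ φ ⟧ ρ → ⟦ ψ ⟧ ρ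
  ⟦ ∀' φ ⟧   ρ = ∀ d → ⟦ φ ⟧ (d ◂ ρ)
  ⟦ t ∈I ⟧   ρ = In (⟦ t ⟧ₜ ρ)

record Model (T : Theory) : Set₁ where
  field
    structure : Structure
  open Semantics structure public
  field
    Eq-stable : ∀ {a b} → Neg (Neg (Eq a b)) → Eq a b
    Lt-stable : ∀ {a b} → Neg (Neg (Lt a b)) → Lt a b
    In-stable : ∀ {a} → Neg (Neg (In a)) → In a
    Eq-refl   : ∀ {a} → Eq a a
    Eq-subst  : ∀ (φ : Fm LAI) ρ {a b} → Eq a b → ⟦ φ ⟧ (a ◂ ρ) → ⟦ φ ⟧ (b ◂ ρ)
    axioms    : ∀ {φ} → T φ → ∀ ρ → ⟦ φ ⟧ ρ

-- A Henkin-style construction without excluded middle: stage n adds the n-th formula under the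
-- hypothesis that its negation proves χ, and Bot is read as T ⊢ χ.
module TermModel (T : Theory) (χ : Fm LAI) where

  Stage Stage½ : ℕ → Fm LAI → Set
  fresh : ℕ → ℕ
  henkin : ℕ → Fm LAI

  fresh zero    = bound χ ⊔ bound (enum 0)
  fresh (suc n) = (fresh n ⊔ bound (enum (suc n))) ⊔ bound (henkin n)

  henkin n = inst (enum n) (var (fresh n)) ⇒ ∀' (enum n)

  Stage zero    ψ = ψ ≡ ¬' χ
  Stage (suc n) ψ = Stage½ n ψ ⊎ (ψ ≡ henkin n × ⊤)

  Stage½ n ψ = Stage n ψ ⊎ (ψ ≡ enum n × (_⊩_ {T} (Stage n) (¬' (enum n)) → T ⊢ χ))

  enum-fresh : ∀ n → bound (enum n) ≤ fresh n
  enum-fresh zero    = m≤n⊔m _ _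
  enum-fresh (suc n) = ≤-trans (m≤n⊔m (fresh n) _) (m≤m⊔n _ _)

  fresh-suc : ∀ n → fresh n ≤ fresh (suc n)
  fresh-suc n = ≤-trans (m≤m⊔n (fresh n) _) (m≤m⊔n _ _)

  stage-fresh : ∀ n {ψ} → Stage n ψ → FreeBelow (fresh n) ψ
  stage½-fresh : ∀ n {ψ} → Stage½ n ψ → FreeBelow (fresh n) ψ
  stage-fresh zero    refl = FreeBelow-mono χ (m≤m⊔n _ _) (bound-below χ) , tt
  stage-fresh (suc n) {ψ} (inj₁ p) = FreeBelow-mono ψ (fresh-suc n) (stage½-fresh n p)
  stage-fresh (suc n) (inj₂ (refl , _)) =
    FreeBelow-mono (henkin n) (m≤n⊔m (fresh n ⊔ bound (enum (suc n))) _) (bound-below (henkin n))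
  stage½-fresh n (inj₁ p) = stage-fresh n p
  stage½-fresh n (inj₂ (refl , _)) = FreeBelow-mono (enum n) (enum-fresh n) (bound-below (enum n))

  infix 1 _⊩ₙ_
  _⊩ₙ_ : ℕ → Fm LAI → Set
  n ⊩ₙ φ = _⊩_ {T} (Stage n) φ

  -- The negated Henkin formula yields both the instance at `fresh n` and the negated universal. All
  -- hypotheses have their variables below `fresh n`, so the instance generalises.
  henkin-conservative : ∀ n → _⊩_ {T} (Stage½ n) (¬' (henkin n)) → _⊩_ {T} (Stage½ n) ⊥'
  henkin-conservative n d with ⊩-¬⇒ˡ d
  ... | Γ , ps , e = ⊩-mp (⊩-¬⇒ʳ d)
    (Γ , ps , ⇛-fresh Γ (All.map (stage½-fresh n) ps)
      (FreeBelow-mono (enum n) (enum-fresh n) (bound-below (enum n))) e)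

  -- The stages are undone one at a time. A use of the n-th formula brings its admission condition
  -- along, and this turns the derived refutation into `T ⊢ χ`. At stage 0 only `¬' χ` has to be
  -- discharged.
  consistent : ∀ n → n ⊩ₙ ⊥' → T ⊢ χ
  consistent zero (Γ , ps , d) = mp ax-DN (discharge (Γ , ps , d))
    where
    discharge : ∀ {φ} → 0 ⊩ₙ φ → T ⊢ ¬' χ ⇒ φ
    discharge ([] , [] , d)           = mp ax-K d
    discharge (_ ∷ Γ , refl ∷ ps , d) = mp (mp ax-S (discharge (Γ , ps , d))) ⊢-I
  consistent (suc n) d = enum-step (⊩-split (henkin-step (⊩-split d)))
    where
    henkin-step : _ → _⊩_ {T} (Stage½ n) ⊥'
    henkin-step (inj₁ e)       = e
    henkin-step (inj₂ (_ , e)) = henkin-conservative n e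
    enum-step : (n ⊩ₙ ⊥') ⊎ _ → T ⊢ χ
    enum-step (inj₁ e)        = consistent n e
    enum-step (inj₂ (ev , e)) = ev e

  infix 1 ⊩ω_
  ⊩ω_ : Fm LAI → Set
  ⊩ω φ = ∃ λ n → n ⊩ₙ φ

  raise : ∀ k {n φ} → n ⊩ₙ φ → k + n ⊩ₙ φ
  raise zero    d = d
  raise (suc k) d = ⊩-mono (inj₁ ∘ inj₁) (raise k d)

  ω-mp : ∀ {φ ψ} → ⊩ω φ ⇒ ψ → ⊩ω φ → ⊩ω ψ
  ω-mp {φ} (m , d) (n , e) =
    n + m , ⊩-mp (raise n d) (subst (_⊩ₙ φ) (+-comm m n) (raise m e))

  ω-pure : ∀ {φ} → T ⊢ φ → ⊩ω φ
  ω-pure d = 0 , ⊩-pure d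

  ω-⊥ : ⊩ω ⊥' → T ⊢ χ
  ω-⊥ (n , d) = consistent n d

  ω-efq : ∀ {φ} → T ⊢ χ → ⊩ω φ
  ω-efq d = 0 , ⊩-efq (⊩-mp (⊩-hyp refl) (⊩-pure d))

  -- `¬' φ` is some `enum n`. Refuting it at stage `n` proves `φ`, so `f` supplies its admission
  -- condition.
  ω-¬ : ∀ {φ} → (⊩ω φ → T ⊢ χ) → ⊩ω ¬' φ
  ω-¬ {φ} f with enum-onto (¬' φ)
  ... | n , eq = suc n , ⊩-hyp (inj₁ (inj₂ (sym eq ,
    λ d → f (n , ⊩-DN (subst (λ θ → n ⊩ₙ ¬' θ) eq d)))))

  ω-stable : ∀ {φ} → ((⊩ω φ → T ⊢ χ) → T ⊢ χ) → ⊩ω φ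
  ω-stable f with ω-¬ (λ d → f (λ e → ω-⊥ (ω-mp d e)))
  ... | n , d = n , ⊩-DN d

  ω-⇒ : ∀ {φ ψ} → (⊩ω φ → ⊩ω ψ) → ⊩ω φ ⇒ ψ
  ω-⇒ f = ω-mp (ω-pure ax-DN) (ω-¬ λ
    { (n , d) → ω-⊥ (ω-mp (n , ⊩-¬⇒ʳ d) (f (n , ⊩-¬⇒ˡ d))) })

  -- The Henkin formula for `φ` enters right after `φ` is enumerated, so one instance, at the fresh
  -- variable, suffices.
  ω-∀ : ∀ {φ} → (∀ t → ⊩ω inst φ t) → ⊩ω ∀' φ
  ω-∀ {φ} f with enum-onto φ
  ... | n , refl = ω-mp (suc n , ⊩-hyp (inj₂ (refl , tt))) (f (var (fresh n)))

  structure : Structure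
  structure = record
    { D = Tm ; zer = `0 ; suc' = S ; plus = _⊕_ ; times = _⊗_
    ; Eq = λ s t → ⊩ω s ≐ t ; Lt = λ s t → ⊩ω s <' t ; In = λ t → ⊩ω t ∈I
    ; Bot = T ⊢ χ }

  open Semantics structure

  ⟦⟧ₜ-subT : ∀ t ρ → ⟦ t ⟧ₜ ρ ≡ subT ρ t
  ⟦⟧ₜ-subT (var k) ρ = refl
  ⟦⟧ₜ-subT `0      ρ = refl
  ⟦⟧ₜ-subT (S t)   ρ = cong S (⟦⟧ₜ-subT t ρ)
  ⟦⟧ₜ-subT (s ⊕ t) ρ = cong₂ _⊕_ (⟦⟧ₜ-subT s ρ) (⟦⟧ₜ-subT t ρ)
  ⟦⟧ₜ-subT (s ⊗ t) ρ = cong₂ _⊗_ (⟦⟧ₜ-subT s ρ) (⟦⟧ₜ-subT t ρ)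

  inst-◂ : ∀ {ρ t} (φ : Fm LAI) → inst (subF (liftS ρ) φ) t ≡ subF (t ◂ ρ) φ
  inst-◂ φ = trans (inst-liftS φ) (subF-cong φ λ { zero → refl ; (suc k) → refl })

  -- Both directions go by one induction because implication swaps them. `ω-⇒` and `ω-∀` are where
  -- the admission of formulas and the Henkin formulas enter.
  truth→ : ∀ (φ : Fm LAI) ρ → ⟦ φ ⟧ ρ → ⊩ω subF ρ φ
  truth← : ∀ (φ : Fm LAI) ρ → ⊩ω subF ρ φ → ⟦ φ ⟧ ρ
  truth→ (s ≐ t)  ρ d = subst ⊩ω_ (cong₂ _≐_ (⟦⟧ₜ-subT s ρ) (⟦⟧ₜ-subT t ρ)) d
  truth→ (s <' t) ρ d = subst ⊩ω_ (cong₂ _<'_ (⟦⟧ₜ-subT s ρ) (⟦⟧ₜ-subT t ρ)) d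
  truth→ ⊥'       ρ d = ω-efq d
  truth→ (φ ⇒ ψ)  ρ f = ω-⇒ λ d → truth→ ψ ρ (f (truth← φ ρ d))
  truth→ (∀' φ)   ρ f = ω-∀ λ t → subst ⊩ω_ (sym (inst-◂ φ)) (truth→ φ (t ◂ ρ) (f t))
  truth→ (t ∈I)   ρ d = subst ⊩ω_ (cong _∈I (⟦⟧ₜ-subT t ρ)) d
  truth← (s ≐ t)  ρ d = subst ⊩ω_ (sym (cong₂ _≐_ (⟦⟧ₜ-subT s ρ) (⟦⟧ₜ-subT t ρ))) d
  truth← (s <' t) ρ d = subst ⊩ω_ (sym (cong₂ _<'_ (⟦⟧ₜ-subT s ρ) (⟦⟧ₜ-subT t ρ))) d
  truth← ⊥'       ρ d = ω-⊥ d
  truth← (φ ⇒ ψ)  ρ d = λ x → truth← ψ ρ (ω-mp d (truth→ φ ρ x))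
  truth← (∀' φ)   ρ d = λ t → truth← φ (t ◂ ρ) (subst ⊩ω_ (inst-◂ φ) (ω-mp (ω-pure (ax-∀E t)) d))
  truth← (t ∈I)   ρ d = subst ⊩ω_ (sym (cong _∈I (⟦⟧ₜ-subT t ρ))) d

  model : Model T
  model = record
    { structure = structure
    ; Eq-stable = ω-stable ; Lt-stable = ω-stable ; In-stable = ω-stable
    ; Eq-refl   = ω-pure (ax-=R _)
    ; Eq-subst  = λ φ ρ {a} {b} e x → truth← φ (b ◂ ρ) (subst ⊩ω_ (inst-◂ φ)
        (ω-mp (ω-mp (ω-pure (ax-=S {φ = subF (liftS ρ) φ} a b)) e)
          (subst ⊩ω_ (sym (inst-◂ φ)) (truth→ φ (a ◂ ρ) x))))
    ; axioms    = λ {φ} a ρ → truth← φ ρ (ω-pure (⊢-subF ρ (ax a)))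
    }

  complete : ⟦ χ ⟧ var → T ⊢ χ
  -- `¬' χ` is a hypothesis from stage 0 on, so truth of `χ` derives falsum at some stage, which
  -- unwinds to `T ⊢ χ`.
  complete x = ω-⊥ (ω-mp (0 , ⊩-hyp refl) (subst ⊩ω_ (subF-var χ) (truth→ χ var x)))

completeness : ∀ {T} χ → ((M : Model T) → ∀ ρ → Model.⟦_⟧ M χ ρ) → T ⊢ χ
completeness {T} χ valid = complete (valid model var)
  where open TermModel T χ

-- Environments and quantifier blocks

module _ {A : Set} where

  ◂-cong : ∀ {a b : A} {ρ τ} → a ≡ b → ρ ≗ τ → (a ◂ ρ) ≗ (b ◂ τ)
  ◂-cong e f zero    = e
  ◂-cong e f (suc k) = f k

  -- A block is given by a whole sequence of which only the first `n` entries count, so blocks carry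
  -- no length in their type.
  app : ℕ → (ℕ → A) → (ℕ → A) → ℕ → A
  app zero    f g = g
  app (suc n) f g = f 0 ◂ app n (f ∘ suc) g

  app-cong : ∀ n {f f' g g' : ℕ → A} → (∀ a → a < n → f a ≡ f' a) → g ≗ g' → app n f g ≗ app n f' g'
  app-cong zero    e e' = e'
  app-cong (suc n) e e' = ◂-cong (e 0 (s≤s z≤n)) (app-cong n (λ a a<n → e (suc a) (s≤s a<n)) e')

  app-< : ∀ n {f g : ℕ → A} a → a < n → app n f g a ≡ f a
  app-< (suc n) zero    _         = refl
  app-< (suc n) (suc a) (s≤s a<n) = app-< n a a<n

  app-drop : ∀ n {f g : ℕ → A} a → app n f g (n + a) ≡ g a
  app-drop zero    a = refl
  app-drop (suc n) a = app-drop n a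

  app-at : ∀ n {f g : ℕ → A} → app n f g n ≡ g 0
  app-at zero    = refl
  app-at (suc n) = app-at n

  app-take : ∀ n {f g h : ℕ → A} → app n (app n f g) h ≗ app n f h
  app-take n = app-cong n (λ a → app-< n a) λ _ → refl

  app-assoc : ∀ m n {f g h : ℕ → A} → app (m + n) (app m f g) h ≗ app m f (app n g h)
  app-assoc zero    n = λ _ → refl
  app-assoc (suc m) n = ◂-cong refl (app-assoc m n)

  app-snoc : ∀ n {f g h : ℕ → A} → app (suc n) (app n f g) h ≗ app n f (g 0 ◂ h)
  app-snoc zero    = ◂-cong refl λ _ → refl
  app-snoc (suc n) = ◂-cong refl (app-snoc n)

  app-last : ∀ n {f g : ℕ → A} → app (suc n) f g ≗ app n f (f n ◂ g)
  app-last zero    = λ _ → refl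
  app-last (suc n) = ◂-cong refl (app-last n)

  app-all : ∀ (P : A → Set) n {f g : ℕ → A} → (∀ a → a < n → P (f a)) → (∀ a → P (g a)) → ∀ a → P (app n f g a)
  app-all P zero    p q a       = q a
  app-all P (suc n) p q zero    = p 0 (s≤s z≤n)
  app-all P (suc n) p q (suc a) = app-all P n (λ b b<n → p (suc b) (s≤s b<n)) q a

app-map : ∀ {A B : Set} (h : A → B) n {f g} → h ∘ app n f g ≗ app n (h ∘ f) (h ∘ g)
app-map h zero    _       = refl
app-map h (suc n) zero    = refl
app-map h (suc n) (suc a) = app-map h n a

TmBelow-renT : ∀ {m} t → TmBelow m t → TmBelow (suc m) (renT suc t)
TmBelow-renT (var k) b       = s≤s b
TmBelow-renT `0      b       = tt
TmBelow-renT (S t)   b       = TmBelow-renT t b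
TmBelow-renT (s ⊕ t) (b , c) = TmBelow-renT s b , TmBelow-renT t c
TmBelow-renT (s ⊗ t) (b , c) = TmBelow-renT s b , TmBelow-renT t c

TmBelow-subT : ∀ {m σ} t → (∀ k → TmBelow m (σ k)) → TmBelow m (subT σ t)
TmBelow-subT (var k) b = b k
TmBelow-subT `0      b = tt
TmBelow-subT (S t)   b = TmBelow-subT t b
TmBelow-subT (s ⊕ t) b = TmBelow-subT s b , TmBelow-subT t b
TmBelow-subT (s ⊗ t) b = TmBelow-subT s b , TmBelow-subT t b

FreeBelow-subF : ∀ {L m σ} (φ : Fm L) → (∀ k → TmBelow m (σ k)) → FreeBelow m (subF σ φ)
FreeBelow-subF (s ≐ t)  b = TmBelow-subT s b , TmBelow-subT t b
FreeBelow-subF (s <' t) b = TmBelow-subT s b , TmBelow-subT t b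
FreeBelow-subF ⊥'       b = tt
FreeBelow-subF (φ ⇒ ψ)  b = FreeBelow-subF φ b , FreeBelow-subF ψ b
FreeBelow-subF {σ = σ} (∀' φ) b = FreeBelow-subF φ λ
  { zero → s≤s z≤n ; (suc k) → TmBelow-renT (σ k) (b k) }
FreeBelow-subF (t ∈I)   b = TmBelow-subT t b

-- A version of `belowBlock` for both languages: indiscernibility is available for formulas of `LA`
-- only, and it is applied to formulas that contain such blocks.
below : ∀ {L} → ℕ → ℕ → Fm L → Fm L
below b zero    ψ = ψ
below b (suc m) ψ = ∀' (var 0 <' var (suc b) ⇒ below (suc b) m ψ)

belowBlock≡below : ∀ b m ψ → belowBlock b m ψ ≡ below b m ψ
belowBlock≡below b zero    ψ = refl
belowBlock≡below b (suc m) ψ = cong (λ θ → ∀' (var 0 <' var (suc b) ⇒ θ)) (belowBlock≡below (suc b) m ψ)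

emb-below : ∀ {L} b m (ψ : Fm L) → emb (below b m ψ) ≡ below b m (emb ψ)
emb-below b zero    ψ = refl
emb-below b (suc m) ψ = cong (λ θ → ∀' (var 0 <' var (suc b) ⇒ θ)) (emb-below (suc b) m ψ)

FreeBelow-below : ∀ {L b m} n (ψ : Fm L) → b < m → FreeBelow (n + m) ψ → FreeBelow m (below b n ψ)
FreeBelow-below         zero    ψ b<m f = f
FreeBelow-below {m = m} (suc n) ψ b<m f =
  (s≤s z≤n , s≤s b<m) , FreeBelow-below n ψ (s≤s b<m) (subst (λ k → FreeBelow k ψ) (sym (+-suc n m)) f)

-- Gives an arbitrary formula the bound on its free variables that the indiscernibility axioms ask
-- for.
truncate : ℕ → ℕ → Tm
truncate n = app n var (λ _ → `0)

truncate-below : ∀ n k → TmBelow n (truncate n k)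
truncate-below n = app-all (TmBelow n) n (λ a a<n → a<n) (λ _ → tt)

-- Substitutions, bounded blocks and increasing blocks in a model

module ModelTheory {T : Theory} (M : Model T) where
  open Model M

  stable : ∀ {L} (φ : Fm L) ρ → Neg (Neg (⟦ φ ⟧ ρ)) → ⟦ φ ⟧ ρ
  stable (s ≐ t)  ρ k = Eq-stable k
  stable (s <' t) ρ k = Lt-stable k
  stable ⊥'       ρ k = k id
  stable (φ ⇒ ψ)  ρ k = λ x → stable ψ ρ λ l → k λ f → l (f x)
  stable (∀' φ)   ρ k = λ d → stable φ (d ◂ ρ) λ l → k λ f → l (f d)
  stable (t ∈I)   ρ k = In-stable k

  ⟦⟧ₜ-sub : ∀ t {σ ρ ρ'} → (∀ k → ⟦ σ k ⟧ₜ ρ ≡ ρ' k) → ⟦ subT σ t ⟧ₜ ρ ≡ ⟦ t ⟧ₜ ρ'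
  ⟦⟧ₜ-sub (var k) e = e k
  ⟦⟧ₜ-sub `0      e = refl
  ⟦⟧ₜ-sub (S t)   e = cong suc' (⟦⟧ₜ-sub t e)
  ⟦⟧ₜ-sub (s ⊕ t) e = cong₂ plus (⟦⟧ₜ-sub s e) (⟦⟧ₜ-sub t e)
  ⟦⟧ₜ-sub (s ⊗ t) e = cong₂ times (⟦⟧ₜ-sub s e) (⟦⟧ₜ-sub t e)

  ⟦⟧ₜ-ren : ∀ t {d ρ} → ⟦ renT suc t ⟧ₜ (d ◂ ρ) ≡ ⟦ t ⟧ₜ ρ
  ⟦⟧ₜ-ren (var k) = refl
  ⟦⟧ₜ-ren `0      = refl
  ⟦⟧ₜ-ren (S t)   = cong suc' (⟦⟧ₜ-ren t)
  ⟦⟧ₜ-ren (s ⊕ t) = cong₂ plus (⟦⟧ₜ-ren s) (⟦⟧ₜ-ren t)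
  ⟦⟧ₜ-ren (s ⊗ t) = cong₂ times (⟦⟧ₜ-ren s) (⟦⟧ₜ-ren t)

  cast : ∀ {A B : Set} → A ≡ B → Iff A B
  cast refl = id , id

  ⟦⟧-sub : ∀ {L} (φ : Fm L) {σ ρ ρ'} → (∀ k → ⟦ σ k ⟧ₜ ρ ≡ ρ' k) → Iff (⟦ subF σ φ ⟧ ρ) (⟦ φ ⟧ ρ')
  ⟦⟧-sub (s ≐ t)  e = cast (cong₂ Eq (⟦⟧ₜ-sub s e) (⟦⟧ₜ-sub t e))
  ⟦⟧-sub (s <' t) e = cast (cong₂ Lt (⟦⟧ₜ-sub s e) (⟦⟧ₜ-sub t e))
  ⟦⟧-sub ⊥'       e = id , id
  ⟦⟧-sub (φ ⇒ ψ)  e = (λ f x → proj₁ (⟦⟧-sub ψ e) (f (proj₂ (⟦⟧-sub φ e) x)))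
                    , (λ f x → proj₂ (⟦⟧-sub ψ e) (f (proj₁ (⟦⟧-sub φ e) x)))
  ⟦⟧-sub (∀' φ) {σ} {ρ} {ρ'} e = (λ f d → proj₁ (⟦⟧-sub φ (e' d)) (f d)) , (λ f d → proj₂ (⟦⟧-sub φ (e' d)) (f d))
    where
    e' : ∀ d k → ⟦ liftS σ k ⟧ₜ (d ◂ ρ) ≡ (d ◂ ρ') k
    e' d zero    = refl
    e' d (suc k) = trans (⟦⟧ₜ-ren (σ k)) (e k)
  ⟦⟧-sub (t ∈I)   e = cast (cong In (⟦⟧ₜ-sub t e))

  ⟦⟧ₜ-local : ∀ {m} t {ρ ρ'} → TmBelow m t → (∀ a → a < m → ρ a ≡ ρ' a) → ⟦ t ⟧ₜ ρ ≡ ⟦ t ⟧ₜ ρ'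
  ⟦⟧ₜ-local (var k) b       e = e k b
  ⟦⟧ₜ-local `0      b       e = refl
  ⟦⟧ₜ-local (S t)   b       e = cong suc' (⟦⟧ₜ-local t b e)
  ⟦⟧ₜ-local (s ⊕ t) (b , c) e = cong₂ plus (⟦⟧ₜ-local s b e) (⟦⟧ₜ-local t c e)
  ⟦⟧ₜ-local (s ⊗ t) (b , c) e = cong₂ times (⟦⟧ₜ-local s b e) (⟦⟧ₜ-local t c e)

  ⟦⟧-local : ∀ {L m} (φ : Fm L) {ρ ρ'} → FreeBelow m φ → (∀ a → a < m → ρ a ≡ ρ' a) → ⟦ φ ⟧ ρ → ⟦ φ ⟧ ρ'
  ⟦⟧-local (s ≐ t)  (b , c) e = proj₁ (cast (cong₂ Eq (⟦⟧ₜ-local s b e) (⟦⟧ₜ-local t c e)))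
  ⟦⟧-local (s <' t) (b , c) e = proj₁ (cast (cong₂ Lt (⟦⟧ₜ-local s b e) (⟦⟧ₜ-local t c e)))
  ⟦⟧-local ⊥'       b       e = id
  ⟦⟧-local (φ ⇒ ψ)  (b , c) e = λ f x → ⟦⟧-local ψ c e (f (⟦⟧-local φ b (λ a a<m → sym (e a a<m)) x))
  ⟦⟧-local (∀' φ)   b       e = λ f d → ⟦⟧-local φ b
    (λ { zero _ → refl ; (suc a) (s≤s a<m) → e a a<m }) (f d)
  ⟦⟧-local (t ∈I)   b       e = proj₁ (cast (cong In (⟦⟧ₜ-local t b e)))

  ext : ∀ {L} (φ : Fm L) {ρ ρ'} → ρ ≗ ρ' → ⟦ φ ⟧ ρ → ⟦ φ ⟧ ρ'
  ext φ e = ⟦⟧-local φ (bound-below φ) λ a _ → e a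

  ⟦⟧-emb : ∀ {L} (φ : Fm L) {ρ} → Iff (⟦ emb φ ⟧ ρ) (⟦ φ ⟧ ρ)
  ⟦⟧-emb (s ≐ t)  = id , id
  ⟦⟧-emb (s <' t) = id , id
  ⟦⟧-emb ⊥'       = id , id
  ⟦⟧-emb (φ ⇒ ψ)  = (λ f x → proj₁ (⟦⟧-emb ψ) (f (proj₂ (⟦⟧-emb φ) x)))
                  , (λ f x → proj₂ (⟦⟧-emb ψ) (f (proj₁ (⟦⟧-emb φ) x)))
  ⟦⟧-emb (∀' φ)   = (λ f d → proj₁ (⟦⟧-emb φ) (f d)) , (λ f d → proj₂ (⟦⟧-emb φ) (f d))
  ⟦⟧-emb (t ∈I)   = id , id

  ∧-elimˡ : ∀ {L} (φ ψ : Fm L) ρ → ⟦ φ ∧' ψ ⟧ ρ → ⟦ φ ⟧ ρ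
  ∧-elimˡ φ ψ ρ h = stable φ ρ λ k → h λ x _ → k x

  ∧-elimʳ : ∀ {L} (φ ψ : Fm L) ρ → ⟦ φ ∧' ψ ⟧ ρ → ⟦ ψ ⟧ ρ
  ∧-elimʳ φ ψ ρ h = stable ψ ρ λ k → h λ _ y → k y

  ⟦closeN⟧ : ∀ {L} m (φ : Fm L) → (∀ ρ → ⟦ closeN m φ ⟧ ρ) → ∀ ρ → ⟦ φ ⟧ ρ
  ⟦closeN⟧ zero    φ h = h
  ⟦closeN⟧ (suc m) φ h ρ =
    ext φ (λ { zero → refl ; (suc k) → refl }) (⟦closeN⟧ m (∀' φ) h (ρ ∘ suc) (ρ 0))

  ⟦below⟧ : ∀ {L} n {b} (ψ : Fm L) {ρ} → Iff (⟦ below b n ψ ⟧ ρ) (∀ X → (∀ a → a < n → Lt (X a) (ρ b)) → ⟦ ψ ⟧ (app n X ρ))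
  ⟦below⟧ zero    ψ = (λ x _ _ → x) , λ f → f (λ _ → zer) (λ _ ())
  ⟦below⟧ (suc n) {b} ψ {ρ} =
      (λ f X lt → ext ψ (λ a → sym (app-last n a))
        (proj₁ (⟦below⟧ n ψ) (f (X n) (lt n ≤-refl)) X λ a a<n → lt a (<-trans a<n (n<1+n n))))
    , (λ f x x<i → proj₂ (⟦below⟧ n ψ) λ X lt → ext ψ (app-snoc n)
        (f (app n X (λ _ → x)) λ a _ → app-all (λ y → Lt y (ρ b)) n lt (λ _ → x<i) a))

  -- Decreasing, since the last variable of an increasing block has de Bruijn index 0.
  Dec : ℕ → Env → Set
  Dec zero          ρ = ⊤
  Dec (suc zero)    ρ = In (ρ 0)
  Dec (suc (suc n)) ρ = In (ρ 0) × Lt (ρ 1) (ρ 0) × Dec (suc n) (ρ ∘ suc)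

  Dec-cong : ∀ n {ρ τ} → ρ ≗ τ → Dec n ρ → Dec n τ
  Dec-cong zero          e d           = d
  Dec-cong (suc zero)    e d           = subst In (e 0) d
  Dec-cong (suc (suc n)) e (d , l , t) =
    subst In (e 0) d , subst₂ Lt (e 1) (e 0) l , Dec-cong (suc n) (e ∘ suc) t

  Dec-head : ∀ n {ρ} → Dec (suc n) ρ → In (ρ 0)
  Dec-head zero    d           = d
  Dec-head (suc n) (d , _ , _) = d

  -- `Dec` unfolds from the largest element, whereas quantifier blocks bind the smallest first; this
  -- passes between the two orders.
  Dec-last : ∀ m J v ρ → Iff (Dec (suc (suc m)) (app m J (v ◂ ρ)))
                               (Dec (suc m) (app m J (v ◂ ρ)) × Lt (ρ 0) v × In (ρ 0))
  Dec-last zero J v ρ          = (λ (a , b , c) → a , b , c) , λ (a , b , c) → a , b , c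
  Dec-last (suc zero) J v ρ    = (λ (a , b , c , d , e) → (a , b , c) , d , e) , λ ((a , b , c) , d , e) → a , b , c , d , e
  Dec-last (suc (suc m)) J v ρ =
      (λ (a , b , c) → let (c' , d , e) = proj₁ (Dec-last (suc m) (J ∘ suc) v ρ) c in (a , b , c') , d , e)
    , λ ((a , b , c) , d , e) → a , b , proj₂ (Dec-last (suc m) (J ∘ suc) v ρ) (c , d , e)

  -- The block J continues ρ 0 to an increasing sequence of elements of I.
  Above : ℕ → Env → Env → Set
  Above r J ρ = Dec (suc r) (app r J ρ)

  Above-base : ∀ r {J ρ} → Above r J ρ → In (ρ 0)
  Above-base zero          d           = d
  Above-base (suc zero)    (_ , _ , d) = d
  Above-base (suc (suc r)) {J} (_ , _ , d) = Above-base (suc r) {J ∘ suc} d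

  Above-last : ∀ r J ρ → Iff (Above (suc r) J ρ) (Above r J (J r ◂ ρ) × Lt (ρ 0) (J r) × In (ρ 0))
  Above-last r J ρ =
      (λ d → proj₁ (Dec-last r J (J r) ρ) (Dec-cong (suc (suc r)) (app-last r) d))
    , (λ p → Dec-cong (suc (suc r)) (λ a → sym (app-last r {J} {ρ} a)) (proj₂ (Dec-last r J (J r) ρ) p))

  infix 4 _≼_
  -- The weak order of the two heads, stated through strict upper bounds so that no disjunction is
  -- involved.
  _≼_ : Env → Env → Set
  ρ ≼ τ = ∀ x → Lt (τ 0) x → Lt (ρ 0) x

  ≼-app : ∀ r {J ρ τ} → ρ ≼ τ → app r J ρ ≼ app r J τ
  ≼-app zero    l = l
  ≼-app (suc r) l = λ _ → id

  -- Only the comparison between the smallest element of the block and its base changes, and `ρ ≼ τ`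
  -- provides the new one.
  Above-rebase : ∀ r {m J ρ τ} → Above r J τ → ρ ≼ τ → Dec (suc m) ρ → Dec (r + suc m) (app r J ρ)
  Above-rebase zero          d           l e = e
  Above-rebase (suc zero)    (a , b , d) l e = a , l _ b , e
  Above-rebase (suc (suc r)) {J = J} (a , b , d) l e = a , b , Above-rebase (suc r) {J = J ∘ suc} d l e

  Above-rebase₁ : ∀ r {J ρ τ} → Above r J τ → ρ ≼ τ → In (ρ 0) → Above r J ρ
  Above-rebase₁ r {J} {ρ} d l i = subst (λ n → Dec n (app r J ρ)) (+-comm r 1) (Above-rebase r {0} d l i)

  Above-++ : ∀ r m {J K ρ} → Above r J (app m K ρ) → Above m K ρ → Above (r + m) (app r J K) ρ
  Above-++ r m {J} {K} {ρ} d e = subst (λ n → Dec n (app (r + m) (app r J K) ρ)) (+-suc r m)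
    (Dec-cong (r + suc m) (λ a → sym (app-assoc r m a)) (Above-rebase r {m} d (λ _ → id) e))

  ⟦incRest⟧ : ∀ m ψ {ρ} → In (ρ 0) → Iff (⟦ incRest m ψ ⟧ ρ) (∀ J → Above m J ρ → ⟦ ψ ⟧ (app m J ρ))
  ⟦incRest⟧ zero    ψ i = (λ x _ _ → x) , λ f → f (λ _ → zer) i
  ⟦incRest⟧ (suc m) ψ {ρ} i =
      (λ f J d → let (e , l , _) = proj₁ (Above-last m J ρ) d ; j = Above-base m {J} e in
        ext ψ (λ a → sym (app-last m a)) (proj₁ (⟦incRest⟧ m ψ j) (f (J m) j l) J e))
    , (λ f v j l → proj₂ (⟦incRest⟧ m ψ j) λ J d → ext ψ (app-snoc m)
        (f (app m J (λ _ → v)) (Dec-cong (suc (suc m)) (λ a → sym (app-snoc m {J} {λ _ → v} {ρ} a))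
          (proj₂ (Dec-last m J v ρ) (d , l , i)))))

  ⟦incBlock⟧ : ∀ m ψ {ρ} → Iff (⟦ incBlock m ψ ⟧ ρ) (∀ J → Dec m (app m J ρ) → ⟦ ψ ⟧ (app m J ρ))
  ⟦incBlock⟧ zero    ψ = (λ x _ _ → x) , λ f → f (λ _ → zer) tt
  ⟦incBlock⟧ (suc m) ψ {ρ} =
      (λ f J d → let e = Dec-cong (suc m) (app-last m) d ; j = Above-base m {J} e in
        ext ψ (λ a → sym (app-last m a)) (proj₁ (⟦incRest⟧ m ψ j) (f (J m) j) J e))
    , (λ f v j → proj₂ (⟦incRest⟧ m ψ j) λ J d → ext ψ (app-snoc m)
        (f (app m J (λ _ → v)) (Dec-cong (suc m) (λ a → sym (app-snoc m a)) d)))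

-- Models of PAI

module PAIModel (M : Model PAI) where
  open Model M
  open ModelTheory M

  Z : Env
  Z _ = zer

  induction : ∀ (φ : Fm LAI) ρ → ⟦ φ ⟧ (zer ◂ ρ) → (∀ d → ⟦ φ ⟧ (d ◂ ρ) → ⟦ φ ⟧ (suc' d ◂ ρ)) → ∀ d → ⟦ φ ⟧ (d ◂ ρ)
  induction φ ρ base step = ⟦closeN⟧ m _ (axioms (ind m φ (FreeBelow-mono φ (n≤1+n m) (bound-below φ)))) ρ
    λ k → k (proj₂ (⟦⟧-sub φ λ { zero → refl ; (suc _) → refl }) base)
            (λ d x → proj₂ (⟦⟧-sub φ λ { zero → refl ; (suc _) → refl }) (step d x))
    where m = bound φ

  -- Equality, order and increasing blocks in a model of arithmetic

  Eq-sym : ∀ {a b} → Eq a b → Eq b a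
  Eq-sym {a} e = Eq-subst (var 0 ≐ var 1) (a ◂ Z) e Eq-refl

  Eq-trans : ∀ {a b c} → Eq a b → Eq b c → Eq a c
  Eq-trans {a} e f = Eq-subst (var 1 ≐ var 0) (a ◂ Z) f e

  suc-cong : ∀ {a b} → Eq a b → Eq (suc' a) (suc' b)
  suc-cong {a} e = Eq-subst (S (var 1) ≐ S (var 0)) (a ◂ Z) e Eq-refl

  plus-congʳ : ∀ c {a b} → Eq a b → Eq (plus c a) (plus c b)
  plus-congʳ c {a} e = Eq-subst (var 2 ⊕ var 1 ≐ var 2 ⊕ var 0) (a ◂ c ◂ Z) e Eq-refl

  Lt-Eq : ∀ {a b c} → Lt a b → Eq b c → Lt a c
  Lt-Eq {a} l e = Eq-subst (var 1 <' var 0) (a ◂ Z) e l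

  Eq-Lt : ∀ {a b c} → Eq a b → Lt b c → Lt a c
  Eq-Lt {c = c} e l = Eq-subst (var 0 <' var 1) (c ◂ Z) (Eq-sym e) l

  suc-inj : ∀ {a b} → Eq (suc' a) (suc' b) → Eq a b
  suc-inj {a} {b} = axioms pa2 Z a b

  suc≢0 : ∀ {a} → Eq (suc' a) zer → Bot
  suc≢0 {a} = axioms pa1 Z a

  -- Disjunctions take this form throughout: refuting every alternative gives `Bot`, which is all
  -- that classical goals require.
  zero-or-suc : ∀ a → Neg (Eq a zer) → (∀ b → Neg (Eq a (suc' b))) → Bot
  zero-or-suc = induction (¬' (var 0 ≐ `0) ⇒ ∀' (¬' (var 1 ≐ S (var 0))) ⇒ ⊥') Z
    (λ f _ → f Eq-refl) (λ d _ _ g → g d Eq-refl)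

  Lt-intro : ∀ {a b} c → Eq (plus a (suc' c)) b → Lt a b
  Lt-intro {a} {b} c e = ∧-elimʳ (var 1 <' var 0 ⇒ sum) (sum ⇒ var 1 <' var 0) (b ◂ a ◂ Z) (axioms pa7 Z a b) λ k → k c e
    where
    sum : Fm LAI
    sum = ∃' (var 2 ⊕ S (var 0) ≐ var 1)

  Lt-elim : ∀ {a b} → Lt a b → Neg (Neg (∃ λ c → Eq (plus a (suc' c)) b))
  Lt-elim {a} {b} l k = ∧-elimˡ (var 1 <' var 0 ⇒ sum) (sum ⇒ var 1 <' var 0) (b ◂ a ◂ Z) (axioms pa7 Z a b) l λ c e → k (c , e)
    where
    sum : Fm LAI
    sum = ∃' (var 2 ⊕ S (var 0) ≐ var 1)

  ≮0 : ∀ {a} → Lt a zer → Bot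
  ≮0 {a} l = Lt-elim l λ (c , e) → suc≢0 (Eq-trans (Eq-sym (axioms pa4 Z a c)) e)

  Lt-suc : ∀ {a} → Lt a (suc' a)
  Lt-suc {a} = Lt-intro zer (Eq-trans (axioms pa4 Z a zer) (suc-cong (axioms pa3 Z a)))

  Lt-sucʳ : ∀ {a b} → Lt a b → Lt a (suc' b)
  Lt-sucʳ {a} {b} l = Lt-stable λ k → Lt-elim l λ (c , e) →
    k (Lt-intro (suc' c) (Eq-trans (axioms pa4 Z a (suc' c)) (suc-cong e)))

  Lt-suc-elim : ∀ {a b} → Lt a (suc' b) → Neg (Lt a b) → Neg (Eq a b) → Bot
  Lt-suc-elim {a} {b} l f g = Lt-elim l λ (c , e) → zero-or-suc c
    (λ c≡0 → g (Eq-trans (Eq-sym (axioms pa3 Z a))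
      (Eq-trans (plus-congʳ a (Eq-sym c≡0)) (a+c≡b c e))))
    (λ d c≡sd → f (Lt-intro d (Eq-trans (plus-congʳ a (Eq-sym c≡sd)) (a+c≡b c e))))
    where
    a+c≡b : ∀ c → Eq (plus a (suc' c)) (suc' b) → Eq (plus a c) b
    a+c≡b c e = suc-inj (Eq-trans (Eq-sym (axioms pa4 Z a c)) e)

  Lt-trans : ∀ {a b c} → Lt a b → Lt b c → Lt a c
  Lt-trans {a} {b} {c} l = induction (var 1 <' var 0 ⇒ var 2 <' var 0) (b ◂ a ◂ Z)
    (λ m → Lt-stable λ _ → ≮0 m)
    (λ d h m → Lt-stable λ k → Lt-suc-elim m (λ n → k (Lt-sucʳ (h n)))
      (λ e → k (Lt-sucʳ (Lt-Eq l e)))) c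

  -- Discreteness of the order, for the successor step of `trichotomy`.
  suc-Lt : ∀ {a b} → Lt a b → Neg (Lt (suc' a) b) → Neg (Eq (suc' a) b) → Bot
  suc-Lt {a} {b} = induction
    (var 1 <' var 0 ⇒ ¬' (S (var 1) <' var 0) ⇒ ¬' (S (var 1) ≐ var 0) ⇒ ⊥') (a ◂ Z)
    (λ l _ _ → ≮0 l)
    (λ d h l f g → Lt-suc-elim l
      (λ m → h m (f ∘ Lt-sucʳ) (λ e → f (Eq-Lt e Lt-suc)))
      (λ e → g (suc-cong e))) b

  trichotomy : ∀ a b → Neg (Lt a b) → Neg (Eq a b) → Neg (Lt b a) → Bot
  trichotomy a b = induction
    (¬' (var 1 <' var 0) ⇒ ¬' (var 1 ≐ var 0) ⇒ ¬' (var 0 <' var 1) ⇒ ⊥') (a ◂ Z)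
    (λ _ → 0≤ a)
    (λ d h f g k → h (f ∘ Lt-sucʳ) (λ e → f (Eq-Lt e Lt-suc))
      (λ l → suc-Lt l k (g ∘ Eq-sym))) b
    where
    0≤ : ∀ a → Neg (Eq a zer) → Neg (Lt zer a) → Bot
    0≤ = induction (¬' (var 0 ≐ `0) ⇒ ¬' (`0 <' var 0) ⇒ ⊥') Z
      (λ f _ → f Eq-refl)
      (λ d h _ k → h (λ e → k (Eq-Lt (Eq-sym e) Lt-suc)) (k ∘ Lt-sucʳ))

  unbounded : ∀ a → Neg (Neg (∃ λ c → In c × Lt a c))
  unbounded a k = axioms unb Z a λ c h → h λ i l → k (c , i , l)

  unbounded₂ : ∀ a b → Neg (Neg (∃ λ c → In c × Lt a c × Lt b c))
  unbounded₂ a b k = trichotomy a b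
    (λ a<b → unbounded b λ (c , i , l) → k (c , i , Lt-trans a<b l , l))
    (λ e → unbounded b λ (c , i , l) → k (c , i , Eq-Lt e l , l))
    (λ b<a → unbounded a λ (c , i , l) → k (c , i , l , Lt-trans b<a l))

  ≼-above : ∀ r {J ρ} → Above r J ρ → ρ ≼ app r J ρ
  ≼-above zero              d           x l = l
  ≼-above (suc zero)        (_ , b , _) x l = Lt-trans b l
  ≼-above (suc (suc r)) {J} (_ , b , d) x l = ≼-above (suc r) {J ∘ suc} d x (Lt-trans b l)

  above-exists : ∀ r ρ → In (ρ 0) → Neg (Neg (∃ λ J → Above r J ρ))
  above-exists zero    ρ i k = k (Z , i)
  above-exists (suc r) ρ i k = unbounded (ρ 0) λ (v , j , l) → above-exists r (v ◂ ρ) j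
    λ (J , d) → k (app r J (λ _ → v) , Dec-cong (suc (suc r)) (λ a → sym (app-snoc r {J} {λ _ → v} {ρ} a))
      (proj₂ (Dec-last r J v ρ) (d , l , i)))

  -- Both tuples are put into one environment, as the two nested blocks of the axiom. Truncating `φ`
  -- has the same effect as evaluating it with the tail `Z`.
  indiscernible : ∀ (φ : Fm LA) n ρ τ → Dec n ρ → Dec n τ → ⟦ φ ⟧ (app n ρ Z) → ⟦ φ ⟧ (app n τ Z)
  indiscernible φ n ρ τ d e x = ext φ (app-take n) (proj₁ (⟦⟧-sub φ (λ a → app-map (λ t → ⟦ t ⟧ₜ env) n {var} {λ _ → `0} a))
    (proj₁ (⟦⟧-emb φ') (∧-elimˡ (ρφ ⇒ τφ) (τφ ⇒ ρφ) env both
      (proj₂ (⟦⟧-sub (emb φ') (λ a → app-drop n {τ} {app n ρ Z} a)) (proj₂ (⟦⟧-emb φ')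
        (proj₂ (⟦⟧-sub φ (λ a → trans (app-map (λ t → ⟦ t ⟧ₜ (app n ρ Z)) n {var} {λ _ → `0} a) (app-take n a))) x))))))
    where
    env : Env
    env = app n τ (app n ρ Z)
    φ' : Fm LA
    φ' = subF (truncate n) φ
    ρφ τφ : Fm LAI
    ρφ = subF (λ m → var (n + m)) (emb φ')
    τφ = emb φ'
    Dec-app : ∀ n {ρ τ} → Dec n ρ → Dec n (app n ρ τ)
    Dec-app zero          d           = tt
    Dec-app (suc zero)    d           = d
    Dec-app (suc (suc n)) (a , b , d) = a , b , Dec-app (suc n) d
    both : ⟦ ρφ ⇔ τφ ⟧ env
    both = proj₁ (⟦incBlock⟧ n (ρφ ⇔ τφ))
      (proj₁ (⟦incBlock⟧ n (incBlock n (ρφ ⇔ τφ)))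
        (axioms (indisc n φ' (FreeBelow-subF φ (truncate-below n))) Z) ρ (Dec-app n d))
      τ (Dec-app n e)

  -- Collection and apartness

  Eq-env : ∀ (φ : Fm LAI) (σ : ℕ → Tm) ρ {τ : D → Env} → (∀ x k → ⟦ σ k ⟧ₜ (x ◂ ρ) ≡ τ x k) →
    ∀ {x y} → Eq x y → ⟦ φ ⟧ (τ x) → ⟦ φ ⟧ (τ y)
  Eq-env φ σ ρ e {x} {y} x≡y p =
    -- The equality axiom replaces at index 0 only; `σ` reads the wanted environment off `x ◂ ρ`, so
    -- other positions can be reached.
    proj₁ (⟦⟧-sub φ (e y)) (Eq-subst (subF σ φ) ρ x≡y (proj₂ (⟦⟧-sub φ (e x)) p))

  -- Induction on `d` for the elements below both `d` and `i`; the guard `x < i` stays because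
  -- witnesses are promised only there.
  collect₁ : ∀ (π : Fm LAI) i ρ →
    (∀ u v x → Lt u v → ⟦ π ⟧ (u ◂ i ◂ x ◂ ρ) → ⟦ π ⟧ (v ◂ i ◂ x ◂ ρ)) →
    (∀ x → Lt x i → Neg (Neg (∃ λ u → ⟦ π ⟧ (u ◂ i ◂ x ◂ ρ)))) →
    Neg (Neg (∃ λ u → ∀ x → Lt x i → ⟦ π ⟧ (u ◂ i ◂ x ◂ ρ)))
  collect₁ π i ρ mono h k = induction κ (i ◂ ρ)
    (λ c → c zer λ x x<0 _ → stable (subF σ π) _ λ _ → ≮0 x<0)
    -- The old bound `u` is tried first. It can fail only at an `x` equal to `d`; as `x < i`, there
    -- is then a witness `v`, and any `w` above `u` and `v` is a new bound.
    (λ d hd c → hd λ u hu → c u λ x x<sd x<i → from λ ¬p →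
      Lt-suc-elim x<sd (λ x<d → ¬p (to (hu x x<d x<i))) λ x≡d →
        h x x<i λ (v , pv) → unbounded₂ u v λ (w , _ , u<w , v<w) → c w λ y y<sd y<i → from λ ¬q →
          Lt-suc-elim y<sd
            (λ y<d → ¬q (mono u w y u<w (to (hu y y<d y<i))))
            (λ y≡d → ¬q (mono v w y v<w (P-Eq v (Eq-trans x≡d (Eq-sym y≡d)) pv))))
    i (λ u f → k (u , λ x x<i → to (f x x<i x<i)))
    where
    σ : ℕ → Tm
    σ = var 1 ◂ var 3 ◂ var 0 ◂ λ k → var (4 + k)
    κ : Fm LAI
    κ = ∃' (∀' (var 0 <' var 2 ⇒ var 0 <' var 3 ⇒ subF σ π))
    P : D → D → Set
    P u x = ⟦ π ⟧ (u ◂ i ◂ x ◂ ρ)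
    σ-env : ∀ {x u d} k → ⟦ σ k ⟧ₜ (x ◂ u ◂ d ◂ i ◂ ρ) ≡ (u ◂ i ◂ x ◂ ρ) k
    σ-env 0 = refl
    σ-env 1 = refl
    σ-env 2 = refl
    σ-env (suc (suc (suc k))) = refl
    to : ∀ {x u d} → ⟦ subF σ π ⟧ (x ◂ u ◂ d ◂ i ◂ ρ) → P u x
    to = proj₁ (⟦⟧-sub π σ-env)
    from : ∀ {x u d} → Neg (Neg (P u x)) → ⟦ subF σ π ⟧ (x ◂ u ◂ d ◂ i ◂ ρ)
    from p = proj₂ (⟦⟧-sub π σ-env) (stable π _ p)
    P-Eq : ∀ u {x y} → Eq x y → P u x → P u y
    P-Eq u = Eq-env π (var 1 ◂ var 2 ◂ var 0 ◂ λ k → var (3 + k)) (u ◂ i ◂ ρ)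
      λ { x 0 → refl ; x 1 → refl ; x 2 → refl ; x (suc (suc (suc k))) → refl }

  -- The variable at index 0 of the block is absorbed into the formula as a bounded quantifier, and
  -- `collect₁` provides the bound uniform in it.
  collect : ∀ n (π : Fm LAI) i ρ →
    (∀ u v τ → Lt u v → ⟦ π ⟧ (u ◂ i ◂ τ) → ⟦ π ⟧ (v ◂ i ◂ τ)) →
    (∀ X → (∀ a → a < n → Lt (X a) i) → Neg (Neg (∃ λ u → ⟦ π ⟧ (u ◂ i ◂ app n X ρ)))) →
    Neg (Neg (∃ λ u → ∀ X → (∀ a → a < n → Lt (X a) i) → ⟦ π ⟧ (u ◂ i ◂ app n X ρ)))
  collect zero    π i ρ mono h k = h Z (λ _ ()) λ (u , p) → k (u , λ _ _ → p)
  collect (suc n) π i ρ mono h k = collect n π' i ρ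
    (λ u v τ u<v f x x<i → from (mono u v (x ◂ τ) u<v (to (f x x<i))))
    (λ X lt l → collect₁ π i (app n X ρ) (λ u v x → mono u v (x ◂ app n X ρ))
      (λ x x<i → h (x ◂ X) λ { zero _ → x<i ; (suc a) (s≤s a<n) → lt a a<n })
      λ (u , f) → l (u , λ x x<i → from (f x x<i)))
    λ (u , f) → k (u , λ X lt → ext π (λ { 0 → refl ; 1 → refl ; (suc (suc k)) → refl })
      (to (f (X ∘ suc) (λ a a<n → lt (suc a) (s≤s a<n)) (X 0) (lt 0 (s≤s z≤n)))))
    where
    σ : ℕ → Tm
    σ = var 1 ◂ var 2 ◂ var 0 ◂ λ k → var (3 + k)
    π' : Fm LAI
    π' = ∀' (var 0 <' var 2 ⇒ subF σ π)
    σ-env : ∀ {x u τ} k → ⟦ σ k ⟧ₜ (x ◂ u ◂ i ◂ τ) ≡ (u ◂ i ◂ x ◂ τ) k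
    σ-env 0 = refl
    σ-env 1 = refl
    σ-env 2 = refl
    σ-env (suc (suc (suc k))) = refl
    to : ∀ {x u τ} → ⟦ subF σ π ⟧ (x ◂ u ◂ i ◂ τ) → ⟦ π ⟧ (u ◂ i ◂ x ◂ τ)
    to = proj₁ (⟦⟧-sub π σ-env)
    from : ∀ {x u τ} → ⟦ π ⟧ (u ◂ i ◂ x ◂ τ) → ⟦ subF σ π ⟧ (x ◂ u ◂ i ◂ τ)
    from = proj₂ (⟦⟧-sub π σ-env)

  apartness : ∀ n (φ : Fm LA) → FreeBelow (suc n) φ → ∀ ρ → ⟦ Apartness n φ ⟧ ρ
  apartness n φ b ρ i i∈I j j∈I i<j = subst (λ θ → ⟦ θ ⟧ (j ◂ i ◂ ρ))
    (trans (emb-below 1 n bounded) (sym (belowBlock≡below 1 n (emb bounded))))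
    (proj₂ (⟦⟧-emb θ) (⟦⟧-local θ θ-free (λ { 0 _ → refl ; 1 _ → refl ; (suc (suc _)) (s≤s (s≤s ())) })
      (stable θ _ λ k → collect n π i Z
        (λ u v τ u<v f h c → f (λ d → h λ y yφ → d y (shift-u yφ)) λ y w → c y λ l → w λ y<u yφ →
          l (Lt-trans y<u u<v) (shift-u yφ))
        -- Whether `φ` has a witness is not decided: the bound 0 is tried, and if the premise holds
        -- with witness `y`, the bound `suc' y` works instead.
        (λ X lt l → l (zer , λ h c → h λ y yφ →
          l (suc' y , λ _ c' → c' y λ w → w Lt-suc (shift-u yφ))))
        λ (u , f) → unbounded₂ u i λ (m , m∈I , u<m , i<m) →
          k (indiscernible θ 2 (m ◂ i ◂ Z) (j ◂ i ◂ Z) (m∈I , i<m , i∈I) (j∈I , i<j , i∈I)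
            (ext θ (λ { 0 → refl ; 1 → refl ; (suc (suc _)) → refl }) (θ-large u f m u<m))))))
    where
    bounded : Fm LA
    bounded = ∃' φ ⇒ ∃' (var 0 <' var (suc n) ∧' φ)
    θ : Fm LA
    θ = below 1 n bounded
    θ-free : FreeBelow 2 θ
    θ-free = FreeBelow-below n bounded (s≤s (s≤s z≤n))
      (((b' , tt) , tt) , ((((s≤s z≤n , s≤s (m<m+n n (s≤s z≤n))) , (b' , tt)) , tt) , tt) , tt)
      where
      b' : FreeBelow (suc (n + 2)) φ
      b' = FreeBelow-mono φ (s≤s (m≤m+n n 2)) b
    σ : ℕ → Tm
    σ = var 0 ◂ λ k → var (3 + k)
    π : Fm LAI
    π = ∃' (subF σ (emb φ)) ⇒ ∃' (var 0 <' var 1 ∧' subF σ (emb φ))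
    σ-env : ∀ {y u ρ} k → ⟦ σ k ⟧ₜ (y ◂ u ◂ i ◂ ρ) ≡ (y ◂ ρ) k
    σ-env 0 = refl
    σ-env (suc k) = refl
    shift-u : ∀ {y u v ρ} → ⟦ subF σ (emb φ) ⟧ (y ◂ u ◂ i ◂ ρ) → ⟦ subF σ (emb φ) ⟧ (y ◂ v ◂ i ◂ ρ)
    shift-u p = proj₂ (⟦⟧-sub (emb φ) σ-env) (proj₁ (⟦⟧-sub (emb φ) σ-env) p)
    retail : ∀ {y X ρ τ} → ⟦ φ ⟧ (y ◂ app n X ρ) → ⟦ φ ⟧ (y ◂ app n X τ)
    retail {y} {X} = ⟦⟧-local φ b λ
      { zero _ → refl ; (suc a) (s≤s a<n) → trans (app-< n a a<n) (sym (app-< n a a<n)) }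
    θ-large : ∀ u → (∀ X → (∀ a → a < n → Lt (X a) i) → ⟦ π ⟧ (u ◂ i ◂ app n X Z)) →
      ∀ m → Lt u m → ⟦ θ ⟧ (m ◂ i ◂ Z)
    θ-large u f m u<m = proj₂ (⟦below⟧ n bounded) λ X lt h c → f X lt
      (λ d → h λ y yφ → d y (proj₂ (⟦⟧-sub (emb φ) σ-env) (proj₂ (⟦⟧-emb φ) (retail yφ))))
      λ y w → c y λ l → w λ y<u yφ → l
        (subst (Lt y) (sym (app-at n)) (Lt-trans y<u u<m))
        (retail (proj₁ (⟦⟧-emb φ) (proj₁ (⟦⟧-sub (emb φ) σ-env) yφ)))

  -- Diagonal indiscernibility in a model

  Bounded : ℕ → Env → D → Set
  Bounded n X i = ∀ a → a < n → Lt (X a) i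

  -- One implication suffices because `J` and `K` can be swapped. The formula and `r` vary: the step
  -- to n + 1 applies the hypothesis to `diagnosis` with blocks of length 3r.
  Diag : ℕ → Set
  Diag n = ∀ r (φ : Fm LA) i J K X → Above r J (i ◂ Z) → Above r K (i ◂ Z) → Bounded n X i →
    ⟦ φ ⟧ (app r J (i ◂ app n X Z)) → ⟦ φ ⟧ (app r K (i ◂ app n X Z))

  module Agreement (n r : ℕ) (φ : Fm LA) where

    -- Only one implication; `diag` recovers the other by also treating `¬' φ`.
    Agree : D → Env → Env → D → Set
    Agree i J K x = ∀ X → Bounded n X i →
      ⟦ φ ⟧ (app r J (i ◂ x ◂ app n X Z)) → ⟦ φ ⟧ (app r K (i ◂ x ◂ app n X Z))

    -- Positions are counted outside the `n` bounded quantifiers of `agree`, hence the offset `n`.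
    slots : ℕ → ℕ → (ℕ → ℕ) → ℕ → Tm
    slots x i J = app r (λ a → var (n + J a)) (var (n + i) ◂ var (n + x) ◂ truncate n)

    agree : ℕ → ℕ → (ℕ → ℕ) → (ℕ → ℕ) → Fm LA
    agree x i J K = below i n (subF (slots x i J) φ ⇒ subF (slots x i K) φ)

    slots-env : ∀ {x i J ρ a b L} X → ρ x ≡ a → ρ i ≡ b → (∀ k → k < r → ρ (J k) ≡ L k) →
      ∀ k → ⟦ slots x i J k ⟧ₜ (app n X ρ) ≡ app r L (b ◂ a ◂ app n X Z) k
    slots-env {x} {i} {J} {ρ} X ex ei eJ k = trans (app-map (λ t → ⟦ t ⟧ₜ (app n X ρ)) r k)
      (app-cong r (λ c c<r → trans (app-drop n (J c)) (eJ c c<r))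
        (λ { 0 → trans (app-drop n i) ei ; 1 → trans (app-drop n x) ex
           ; (suc (suc c)) → trans (app-map (λ t → ⟦ t ⟧ₜ (app n X ρ)) n {var} {λ _ → `0} c) (app-take n c) }) k)

    ⟦agree⟧ : ∀ {x i J K ρ a b L N} → ρ x ≡ a → ρ i ≡ b →
      (∀ k → k < r → ρ (J k) ≡ L k) → (∀ k → k < r → ρ (K k) ≡ N k) →
      Iff (⟦ agree x i J K ⟧ ρ) (Agree b L N a)
    ⟦agree⟧ {x} {i} {J} {K} {ρ} {a} {L = L} {N} ex refl eJ eK =
        (λ f X lt p → proj₁ (⟦⟧-sub φ (slots-env X ex refl eK))
          (proj₁ (⟦below⟧ n body) f X lt (proj₂ (⟦⟧-sub φ (slots-env X ex refl eJ)) p)))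
      , (λ f → proj₂ (⟦below⟧ n body) λ X lt p → proj₂ (⟦⟧-sub φ (slots-env X ex refl eK))
          (f X lt (proj₁ (⟦⟧-sub φ (slots-env X ex refl eJ)) p)))
      where
      body : Fm LA
      body = subF (slots x i J) φ ⇒ subF (slots x i K) φ

    Agree-stable : ∀ {i J K x} → Neg (Neg (Agree i J K x)) → Agree i J K x
    Agree-stable k X lt p = stable φ _ λ ¬p → k λ f → ¬p (f X lt p)

    φ-Eq : ∀ i J X {x y} → Eq x y → ⟦ φ ⟧ (app r J (i ◂ x ◂ X)) → ⟦ φ ⟧ (app r J (i ◂ y ◂ X))
    φ-Eq i J X e p = proj₁ (⟦⟧-emb φ) (Eq-env (emb φ) σ (app r J (i ◂ X)) σ-env e (proj₂ (⟦⟧-emb φ) p))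
      where
      σ : ℕ → Tm
      σ = app r (λ a → var (suc a)) (var (suc (r + 0)) ◂ var 0 ◂ λ a → var (suc (r + suc a)))
      σ-env : ∀ x k → ⟦ σ k ⟧ₜ (x ◂ app r J (i ◂ X)) ≡ app r J (i ◂ x ◂ X) k
      σ-env x k = trans (app-map (λ t → ⟦ t ⟧ₜ (x ◂ app r J (i ◂ X))) r k)
        (app-cong r (λ a → app-< r a) (λ { 0 → app-drop r 0 ; 1 → refl ; (suc (suc a)) → app-drop r (suc a) }) k)

    Agree-Eq : ∀ {i J K x y} → Eq x y → Agree i J K x → Agree i J K y
    Agree-Eq {i} {J} {K} e f X lt p = φ-Eq i K (app n X Z) e (f X lt (φ-Eq i J (app n X Z) (Eq-sym e) p))

    -- The index of `i` inside `diagnosis`, behind its bound variable and three blocks. The summand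
    -- 0 keeps the shape that `app-drop` produces.
    iₓ : ℕ
    iₓ = suc (r + (r + (r + 0)))

    diagnosis-slots : ℕ → Tm
    diagnosis-slots = app r (λ a → var (suc a)) (var iₓ ◂ var 0 ◂ λ a → var (suc (r + (r + (r + suc a)))))

    -- φ at the first disagreement between J and K, as a formula in L, K, J, i and the remaining variables.
    diagnosis : Fm LA
    diagnosis = ∀' (¬' (agree 0 iₓ (λ a → suc (r + (r + a))) (λ a → suc (r + a)))
      ⇒ ∀' (var 0 <' var 1 ⇒ agree 0 (suc iₓ) (λ a → suc (suc (r + (r + a)))) (λ a → suc (suc (r + a))))
      ⇒ subF diagnosis-slots φ)

    ⟦diagnosis⟧ : ∀ {i J K L W} → Iff (⟦ diagnosis ⟧ (app r L (app r K (app r J (i ◂ W)))))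
      (∀ x → Neg (Agree i J K x) → (∀ y → Lt y x → Agree i J K y) → ⟦ φ ⟧ (app r L (i ◂ x ◂ W)))
    ⟦diagnosis⟧ {i} {J} {K} {L} {W} =
        (λ f x ¬p all → proj₁ (⟦⟧-sub φ σ-env) (f x (λ a → ¬p (proj₁ (at x) a)) λ y y<x → proj₂ (at' x y) (all y y<x)))
      , (λ f x ¬p all → proj₂ (⟦⟧-sub φ σ-env) (f x (λ a → ¬p (proj₂ (at x) a)) λ y y<x → proj₁ (at' x y) (all y y<x)))
      where
      ρ : Env
      ρ = app r L (app r K (app r J (i ◂ W)))
      eJ : ∀ k → k < r → ρ (r + (r + k)) ≡ J k
      eJ k k<r = trans (app-drop r (r + k)) (trans (app-drop r k) (app-< r k k<r))
      eK : ∀ k → k < r → ρ (r + k) ≡ K k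
      eK k k<r = trans (app-drop r k) (app-< r k k<r)
      eW : ∀ k → ρ (r + (r + (r + k))) ≡ (i ◂ W) k
      eW k = trans (app-drop r _) (trans (app-drop r (r + k)) (app-drop r k))
      at : ∀ x → Iff (⟦ agree 0 iₓ (λ a → suc (r + (r + a))) (λ a → suc (r + a)) ⟧ (x ◂ ρ)) (Agree i J K x)
      at x = ⟦agree⟧ {0} {suc (r + (r + (r + 0)))} {λ a → suc (r + (r + a))} {λ a → suc (r + a)} {x ◂ ρ} {L = J} {K} refl (eW 0) eJ eK
      at' : ∀ x y → Iff (⟦ agree 0 (suc iₓ) (λ a → suc (suc (r + (r + a)))) (λ a → suc (suc (r + a))) ⟧ (y ◂ x ◂ ρ)) (Agree i J K y)
      at' x y = ⟦agree⟧ {0} {suc (suc (r + (r + (r + 0))))} {λ a → suc (suc (r + (r + a)))} {λ a → suc (suc (r + a))} {y ◂ x ◂ ρ} {L = J} {K} refl (eW 0) eJ eK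
      σ-env : ∀ {x} k → ⟦ diagnosis-slots k ⟧ₜ (x ◂ ρ) ≡ app r L (i ◂ x ◂ W) k
      σ-env {x} k = trans (app-map (λ t → ⟦ t ⟧ₜ (x ◂ ρ)) r k) (app-cong r (λ a → app-< r {L} {app r K (app r J (i ◂ W))} a)
        (λ { 0 → eW 0 ; 1 → refl ; (suc (suc a)) → eW (suc a) }) k)

    module _ (IH : Diag n) where

      -- `diagnosis` states φ at `x` without having `x` as a parameter, so `Diag n` applies to the
      -- tuples J, K, L and J, K, N over `i`.
      agree-beyond : ∀ {i J K L N x} → Above r J (i ◂ Z) → Above r K (app r J (i ◂ Z)) →
        Above r L (app r K (app r J (i ◂ Z))) → Above r N (app r L (app r K (app r J (i ◂ Z)))) →
        Neg (Agree i J K x) → (∀ y → Lt y x → Agree i J K y) → Agree i L N x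
      agree-beyond {i} {J} {K} {L} {N} {x} aJ aK aL aN ¬p all X lt p =
        proj₁ ⟦diagnosis⟧ (ext diagnosis (assoc N)
          (IH (r + (r + r)) diagnosis i (app r L (app r K J)) (app r N (app r K J)) X
            (stack aL) (stack (Above-rebase₁ r aN (≼-above r aL) (Dec-head r {app r K (app r J (i ◂ Z))} aK)))
            -- Any first disagreement `y` equals `x` by trichotomy, so `p` transfers to it along the
            -- equality.
            lt (ext diagnosis (λ a → sym (assoc L a)) (proj₂ ⟦diagnosis⟧ λ y ¬q all' → stable φ _ λ k →
              trichotomy x y (λ x<y → ¬p (all' x x<y)) (λ e → k (φ-Eq i L (app n X Z) e p)) (λ y<x → ¬q (all y y<x))))))
          x ¬p all
        where
        assoc : ∀ H → app (r + (r + r)) (app r H (app r K J)) (i ◂ app n X Z) ≗ app r H (app r K (app r J (i ◂ app n X Z)))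
        assoc H a = trans (app-assoc r (r + r) a) (app-cong r (λ _ _ → refl) (app-assoc r r) a)
        stack : ∀ {H} → Above r H (app r K (app r J (i ◂ Z))) → Above (r + (r + r)) (app r H (app r K J)) (i ◂ Z)
        stack {H} aH = Above-++ r (r + r) (Dec-cong (suc r)
          (app-cong r (λ _ _ → refl) (λ a → sym (app-assoc r r {K} {J} {i ◂ Z} a))) aH) (Above-++ r r aK aJ)

      lower : ∀ {J L ρ τ} → ρ ≼ τ → In (ρ 0) → Above r J τ → Above r L (app r J τ) →
        Above r J ρ × Above r L (app r J ρ)
      lower {J} {L} {ρ} {τ} l i aJ aL = aJ' , Above-rebase₁ r aL (≼-app r {J} {ρ} {τ} l) (Dec-head r {app r J ρ} aJ')
        where
        aJ' : Above r J ρ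
        aJ' = Above-rebase₁ r aJ l i

      Settled : D → D → D → Set
      Settled i x j = ∀ J L → Above r J (j ◂ Z) → Above r L (app r J (j ◂ Z)) → ∀ y → Lt y x → Agree i J L y

      -- The induction formula `κ` mentions `I`, both for `j` and in the two blocks, so this rests
      -- on induction in the full language.
      settle : ∀ i → In i → ∀ x → Neg (Neg (∃ λ j → In j × Lt i j × Settled i x j))
      settle i i∈I x k = induction κ (i ◂ Z)
        (λ c → unbounded i λ (j , j∈I , i<j) → c j j∈I i<j
          (from j∈I λ J L aJ aL y y<0 → Agree-stable λ _ → ≮0 y<0))
        (λ d hd c → hd λ j j∈I i<j hj → extend d j j∈I i<j (to j∈I hj) λ j' j'∈I i<j' h → c j' j'∈I i<j' (from j'∈I h))
        x (λ j j∈I i<j h → k (j , j∈I , i<j , to j∈I h))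
        where
        α : Fm LA
        α = agree 0 (suc (r + (r + 2))) (λ a → suc (r + a)) suc
        matrix : Fm LAI
        matrix = ∀' (var 0 <' var (suc (r + (r + 1))) ⇒ emb α)
        κ : Fm LAI
        κ = ¬' (∀' (var 0 ∈I ⇒ var 2 <' var 0 ⇒ ¬' (incRest r (incRest r matrix))))
        ⟦matrix⟧ : ∀ {j x J L} → Iff (⟦ matrix ⟧ (app r L (app r J (j ◂ x ◂ i ◂ Z)))) (∀ y → Lt y x → Agree i J L y)
        ⟦matrix⟧ {j} {x} {J} {L} =
            (λ f y l → proj₁ (at y) (proj₁ (⟦⟧-emb α) (f y (subst (Lt y) (sym (eW 1)) l))))
          , (λ f y l → proj₂ (⟦⟧-emb α) (proj₂ (at y) (f y (subst (Lt y) (eW 1) l))))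
          where
          ρ : Env
          ρ = app r L (app r J (j ◂ x ◂ i ◂ Z))
          eW : ∀ k → ρ (r + (r + k)) ≡ (j ◂ x ◂ i ◂ Z) k
          eW k = trans (app-drop r _) (app-drop r k)
          at : ∀ y → Iff (⟦ α ⟧ (y ◂ ρ)) (Agree i J L y)
          at y = ⟦agree⟧ {0} {suc (r + (r + 2))} {λ a → suc (r + a)} {suc} {y ◂ ρ} {L = J} {L} refl (eW 2)
            (λ k k<r → trans (app-drop r k) (app-< r k k<r)) (λ k → app-< r k)
        to : ∀ {j x} → In j → ⟦ incRest r (incRest r matrix) ⟧ (j ◂ x ◂ i ◂ Z) → Settled i x j
        to {j} {x} j∈I f J L aJ aL =
          let aJ' , aL' = lower {J} {L} {j ◂ x ◂ i ◂ Z} {j ◂ Z} (λ _ → id) j∈I aJ aL in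
          proj₁ (⟦matrix⟧ {j} {x} {J} {L}) (proj₁ (⟦incRest⟧ r matrix (Dec-head r {app r J (j ◂ x ◂ i ◂ Z)} aJ'))
            (proj₁ (⟦incRest⟧ r (incRest r matrix) j∈I) f J aJ') L aL')
        from : ∀ {j x} → In j → Settled i x j → ⟦ incRest r (incRest r matrix) ⟧ (j ◂ x ◂ i ◂ Z)
        from {j} {x} j∈I f = proj₂ (⟦incRest⟧ r (incRest r matrix) j∈I) λ J aJ →
          proj₂ (⟦incRest⟧ r matrix (Dec-head r {app r J (j ◂ x ◂ i ◂ Z)} aJ)) λ L aL →
          let aJ' , aL' = lower {J} {L} {j ◂ Z} {j ◂ x ◂ i ◂ Z} (λ _ → id) j∈I aJ aL in
          proj₂ (⟦matrix⟧ {j} {x} {J} {L}) (f J L aJ' aL')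
        -- The old `j` is tried first. A failure gives `J`, `L` and some `y` equal to `d` where they
        -- first disagree, and `agree-beyond` then settles `d` for all blocks above `L`.
        extend : ∀ d j → In j → Lt i j → Settled i d j →
          Neg (∀ j' → In j' → Lt i j' → Neg (Settled i (suc' d) j'))
        extend d j j∈I i<j hj c = c j j∈I i<j λ J L aJ aL y y<sd → Agree-stable λ ¬p →
          Lt-suc-elim y<sd (λ y<d → ¬p (hj J L aJ aL y y<d)) λ y≡d →
          -- The head of this environment is the largest element of the two blocks, or `j` itself
          -- when the blocks are empty.
          unbounded₂ i (app r L (app r J (j ◂ Z)) 0) λ (j' , j'∈I , i<j' , h<j') → c j' j'∈I i<j'
          λ J' L' aJ' aL' z z<sd → Agree-stable λ ¬q → Lt-suc-elim z<sd
            (λ z<d → ¬q (let aJ₁ , aL₁ = lower {J'} {L'} {j ◂ Z} {j' ◂ Z}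
                                (λ x l → ≼-above r {J} {j ◂ Z} aJ x (≼-above r {L} {app r J (j ◂ Z)} aL x (Lt-trans h<j' l)))
                                j∈I aJ' aL'
                          in hj J' L' aJ₁ aL₁ z z<d))
            (λ z≡d → ¬q (Agree-Eq (Eq-trans y≡d (Eq-sym z≡d))
              (let i≼j = λ x → Lt-trans i<j
                   aJ₀ , aL₀ = lower {J} {L} {i ◂ Z} {j ◂ Z} i≼j i∈I aJ aL
                   aJ₁ , aL₁ = lower {J'} {L'} {app r L (app r J (i ◂ Z))} {j' ◂ Z}
                     (λ x l → ≼-app r {L} (≼-app r {J} {i ◂ Z} {j ◂ Z} i≼j) x (Lt-trans h<j' l))
                     (Dec-head r {app r L (app r J (i ◂ Z))} aL₀) aJ' aL'
               in agree-beyond aJ₀ aL₀ aJ₁ aL₁ ¬p λ w w<y → hj J L aJ aL w (Lt-Eq w<y y≡d))))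

      -- `settle` at `x = i` yields one pair of blocks that agree below `i`. This is the formula `β`
      -- in `i` and the two blocks alone, so it passes to every such pair.
      uniform : ∀ {i J L} → Above r J (i ◂ Z) → Above r L (app r J (i ◂ Z)) → ∀ x → Lt x i → Agree i J L x
      uniform {i} {J} {L} aJ aL x x<i = Agree-stable λ ¬p → settle i i∈I i λ (j , j∈I , i<j , hj) →
        above-exists r (j ◂ Z) j∈I λ (J' , aJ') →
        above-exists r (app r J' (j ◂ Z)) (Dec-head r {app r J' (j ◂ Z)} aJ') λ (L' , aL') →
        let aJ₀ , aL₀ = lower {J'} {L'} {i ◂ Z} {j ◂ Z} (λ _ → Lt-trans i<j) i∈I aJ' aL' in
        ¬p (proj₁ (⟦β⟧ {J} {L}) (ext β (assoc J L) (indiscernible β (suc (r + r)) _ _ (Above-++ r r aL₀ aJ₀) (Above-++ r r aL aJ)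
          (ext β (λ a → sym (assoc J' L' a)) (proj₂ (⟦β⟧ {J'} {L'}) (hj J' L' aJ' aL')))))
          x x<i)
        where
        i∈I : In i
        i∈I = Above-base r aJ
        α β : Fm LA
        α = agree 0 (suc (r + (r + 0))) (λ a → suc (r + a)) suc
        β = ∀' (var 0 <' var (suc (r + (r + 0))) ⇒ α)
        assoc : ∀ J L → app (suc (r + r)) (app (r + r) (app r L J) (i ◂ Z)) Z ≗ app r L (app r J (i ◂ Z))
        assoc J L a = trans (app-snoc (r + r) {app r L J} {i ◂ Z} {Z} a) (app-assoc r r a)
        ⟦β⟧ : ∀ {J L} → Iff (⟦ β ⟧ (app r L (app r J (i ◂ Z)))) (∀ y → Lt y i → Agree i J L y)
        ⟦β⟧ {J} {L} =
            (λ f y l → proj₁ (at y) (f y (subst (Lt y) (sym eᵢ) l)))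
          , (λ f y l → proj₂ (at y) (f y (subst (Lt y) eᵢ l)))
          where
          ρ : Env
          ρ = app r L (app r J (i ◂ Z))
          eᵢ : ρ (r + (r + 0)) ≡ i
          eᵢ = trans (app-drop r _) (app-drop r 0)
          at : ∀ y → Iff (⟦ α ⟧ (y ◂ ρ)) (Agree i J L y)
          at y = ⟦agree⟧ {0} {suc (r + (r + 0))} {λ a → suc (r + a)} {suc} {y ◂ ρ} {L = J} {L} refl eᵢ
            (λ k k<r → trans (app-drop r k) (app-< r k k<r)) (λ k → app-< r k)

  open Agreement using (uniform)

  diag : ∀ n → Diag n
  diag zero r φ i J K X aJ aK _ p = ext φ (app-snoc r {K} {i ◂ Z} {Z})
    (indiscernible φ (suc r) (app r J (i ◂ Z)) (app r K (i ◂ Z)) aJ aK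
      (ext φ (λ a → sym (app-snoc r {J} {i ◂ Z} {Z} a)) p))
  diag (suc n) r φ i J K X aJ aK lt p = stable φ _ λ ¬p →
    unbounded₂ (app r J (i ◂ Z) 0) (app r K (i ◂ Z) 0) λ (c , c∈I , J<c , K<c) →
    above-exists r (c ◂ Z) c∈I λ (L , aL) →
    -- From `J` to `L` the formula `φ` is carried upwards; from `K` to `L` its negation is, and the
    -- two clash at `L`.
    uniform n r (¬' φ) (diag n) aK
      (Above-rebase₁ r {L} {app r K (i ◂ Z)} {c ◂ Z} aL (λ _ → Lt-trans K<c) (Dec-head r {app r K (i ◂ Z)} aK)) (X 0) (lt 0 (s≤s z≤n)) (X ∘ suc) lt' ¬p
      (uniform n r φ (diag n) aJ
        (Above-rebase₁ r {L} {app r J (i ◂ Z)} {c ◂ Z} aL (λ _ → Lt-trans J<c) (Dec-head r {app r J (i ◂ Z)} aJ)) (X 0) (lt 0 (s≤s z≤n)) (X ∘ suc) lt' p)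
    where
    lt' : Bounded n (X ∘ suc) i
    lt' a a<n = lt (suc a) (s≤s a<n)

  -- Passage from blocks of values to the scheme `Diagonal`

  ⟦diagSub⟧ : ∀ n r off (φ : Fm LA) {ρ F i X} → FreeBelow (n + 1 + r) φ →
    (∀ a → a < r → ρ (off + a) ≡ F a) → ρ (n + (r + r)) ≡ i → (∀ a → a < n → ρ a ≡ X a) →
    Iff (⟦ subF (diagSub n r off) (emb φ) ⟧ ρ) (⟦ φ ⟧ (app r F (i ◂ app n X Z)))
  ⟦diagSub⟧ n r off φ {ρ} {F} {i} {X} b eF eᵢ eX =
      (λ p → ⟦⟧-local φ b env (proj₁ (⟦⟧-emb φ) (proj₁ (⟦⟧-sub (emb φ) λ _ → refl) p)))
    , (λ p → proj₂ (⟦⟧-sub (emb φ) λ _ → refl) (proj₂ (⟦⟧-emb φ) (⟦⟧-local φ b (λ a a< → sym (env a a<)) p)))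
    where
    env : ∀ k → k < n + 1 + r → ⟦ diagSub n r off k ⟧ₜ ρ ≡ app r F (i ◂ app n X Z) k
    env k k< with k <ᵇ r in eq
    ... | true = trans (eF k k<r) (sym (app-< r k k<r))
      where
      k<r : k < r
      k<r = <ᵇ⇒< k r (subst T (sym eq) tt)
    ... | false with k ≡ᵇ r in eq'
    ...   | true rewrite ≡ᵇ⇒≡ k r (subst T (sym eq') tt) = trans eᵢ (sym (app-at r))
    ...   | false = trans (eX c c<n) (sym (trans (cong (app r F (i ◂ app n X Z)) k≡) (trans (app-drop r (suc c)) (app-< n c c<n))))
      where
      c : ℕ
      c = k ∸ suc r
      r<k : suc r ≤ k
      r<k = ≤∧≢⇒< (≮⇒≥ λ k<r → subst T eq (<⇒<ᵇ k<r)) λ r≡k → subst T eq' (≡⇒≡ᵇ k r (sym r≡k))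
      k≡ : k ≡ r + suc c
      k≡ = trans (sym (m+[n∸m]≡n r<k)) (sym (+-suc r c))
      -- Here `k` exceeds `r`, and the bound on the free variables of `φ` places it among the x̄.
      c<n : c < n
      c<n = +-cancelˡ-< (suc r) c n (subst₂ _<_ (sym (m+[n∸m]≡n r<k))
        (trans (cong (_+ r) (+-comm n 1)) (cong suc (+-comm n r))) k<)

  diagonal : ∀ n r (φ : Fm LA) → 1 ≤ r → FreeBelow (n + 1 + r) φ → ∀ ρ → ⟦ Diagonal n r φ ⟧ ρ
  diagonal n r@(suc r') φ _ b ρ i i∈I =
    proj₂ (⟦incBlock⟧ r _) λ J dJ → proj₂ (⟦incBlock⟧ r _) λ K dK h →
    let E   = app r K (app r J (i ◂ ρ))
        -- The smallest element of `J` sits at index `r'` of its block, thus at `r + r'` behind the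
        -- block `K`; this is `r + r ∸ 1` up to `+-suc`.
        i<J = subst₂ Lt (at-i r J K) (trans (cong E (+-suc r' r')) (at-J r J K r' ≤-refl))
                (∧-elimˡ {LAI} (var (r + r) <' var (r + r ∸ 1)) (var (r + r) <' var r') E h)
        i<K = subst₂ Lt (at-i r J K) (at-K r J K r' ≤-refl)
                (∧-elimʳ {LAI} (var (r + r) <' var (r + r ∸ 1)) (var (r + r) <' var r') E h)
        aJ  = above {J} {i ◂ ρ} dJ i<J
        aK  = above {K} {app r J (i ◂ ρ)} dK i<K
    in subst (λ θ → ⟦ θ ⟧ E) (sym (belowBlock≡below (r + r) n (φJ ⇔ φK)))
      (proj₂ (⟦below⟧ n (φJ ⇔ φK)) λ X lt c →
        let lt'  = λ a a<n → subst (Lt (X a)) (at-i r J K) (lt a a<n)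
            eᵢ   = trans (app-drop n {X} {E} (r + r)) (at-i r J K)
            iffJ = ⟦diagSub⟧ n r (n + r) φ {app n X E} {J} {i} {X} b
              (λ a a<r → trans (cong (app n X E) (+-assoc n r a))
                (trans (app-drop n {X} {E} (r + a)) (at-J r J K a a<r)))
              eᵢ (λ a → app-< n {X} {E} a)
            iffK = ⟦diagSub⟧ n r n φ {app n X E} {K} {i} {X} b
              (λ a a<r → trans (app-drop n {X} {E} a) (at-K r J K a a<r)) eᵢ (λ a → app-< n {X} {E} a)
        in c (λ p → proj₂ iffK (diag n r φ i J K X aJ aK lt' (proj₁ iffJ p)))
             (λ p → proj₂ iffJ (diag n r φ i K J X aK aJ lt' (proj₁ iffK p))))
    where
    φJ φK : Fm LAI
    φJ = subF (diagSub n r (n + r)) (emb φ)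
    φK = subF (diagSub n r n) (emb φ)
    at-i : ∀ r J K → app r K (app r J (i ◂ ρ)) (r + r) ≡ i
    at-i r J K = trans (app-drop r r) (app-at r)
    at-J : ∀ r J K a → a < r → app r K (app r J (i ◂ ρ)) (r + a) ≡ J a
    at-J r J K a a<r = trans (app-drop r a) (app-< r a a<r)
    at-K : ∀ r J K a → a < r → app r K (app r J (i ◂ ρ)) a ≡ K a
    at-K r J K a = app-< r a
    -- `Dec` of the block alone does not involve `i`; comparing `i` with the smallest element `J r'`
    -- supplies the missing link.
    above : ∀ {J ρ} → Dec r (app r J ρ) → Lt i (J r') → Above r J (i ◂ Z)
    above {J} {ρ} d i<J =
      let e = Dec-cong r (app-last r' {J} {ρ}) d in
      proj₂ (Above-last r' J (i ◂ Z))
        (Above-rebase₁ r' {J} {J r' ◂ i ◂ Z} {J r' ◂ ρ} e (λ _ → id) (Above-base r' {J} {J r' ◂ ρ} e) , i<J , i∈I)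

theorem3p5 : ((n : ℕ) (φ : Fm LA) → FreeBelow (suc n) φ → PAI ⊢ Apartness n φ)
    × ((n r : ℕ) (φ : Fm LA) → 1 ≤ r → FreeBelow (n + 1 + r) φ
    → PAI ⊢ Diagonal n r φ)
theorem3p5 =
    (λ n φ b → completeness _ λ M → PAIModel.apartness M n φ b)
  , (λ n r φ r≥1 b → completeness _ λ M → PAIModel.diagonal M n r φ r≥1 b)
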